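{- For each positive integer $n$, let $C_n$ be the set of $n\times n$ permutation matrices $\alpha$ such that the coefficient of the monomial $z^{\alpha}=\prod_{i,j} z_{i,j}^{\alpha_{i,j}}$ in the bitableau $[P_\alpha\mid Q_\alpha]$ is $0$. Then \[\lim_{n\to\infty}\frac{|C_n|}{n!}=1.\]
   Context: Let $z_{i,j}$ ($i,j\ge1$) be commuting indeterminates. For an $n\times n$ permutation matrix $\alpha$, let $w_\alpha=w_1\cdots w_n\in S_n$ be defined by $\alpha_{w_i,i}=1$ for all $i$, so $z^\alpha=z_{w_1,1}z_{w_2,2}\cdots z_{w_n,n}$. The pair $(P_\alpha,Q_\alpha)$ (the RSK image of $\alpha$) is obtained as follows: $P_\alpha$ is the Schensted insertion tableau of $w_\alpha$ (insert $w_1,\dots,w_n$ successively; a number $x$ inserted into a row is appended if larger than all entries, otherwise it replaces the smallest larger entry $y$, which is inserted into the next row up in the same way; French notation), and $Q_\alpha$ is the recording tableau: whenever step $i$ creates a new box in the insertion tableau, a box containing $i$ is created in the same position of $Q_\alpha$. For a pair $(P,Q)$ of standard Young tableaux of the same shape $\lambda$, for each column $j$ ($1\le j\le\lambda_1$) let $\Delta_j$ be the determinant of the square submatrix of the infinite matrix $(z_{i,k})_{i,k\ge1}$ whose rows are indexed by the entries of column $j$ of $P$ and whose columns are indexed by the entries of column $j$ of $Q$ (both in increasing order). The bitableau is $[P\mid Q]=\prod_j\Delta_j$. -}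

module Defs where

open import Data.Nat using (ℕ; zero; suc; _+_; _<ᵇ_; _≡ᵇ_; NonZero; _!)
open import Data.Nat.Properties using (_!≢0)

open import Data.Bool using (Bool; true; false; if_then_else_; _∧_)
open import Data.List using (List; []; _∷_; _++_; [_]; map; concatMap; length; zip; upTo; sum; foldr; applyUpTo)
open import Data.Maybe using (Maybe; just; nothing)
open import Data.Product using (_×_; _,_; proj₁; proj₂)
open import Data.Integer as ℤ using (ℤ; +_; -_; 1ℤ; 0ℤ)
open import Data.Rational using (ℚ; _/_)

insertions : ℕ → List ℕ → List (List ℕ)
insertions x []       = [ x ∷ [] ]
insertions x (y ∷ ys) = (x ∷ y ∷ ys) ∷ map (y ∷_) (insertions x ys)

perms : List ℕ → List (List ℕ)
perms []       = [ [] ]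
perms (x ∷ xs) = concatMap (insertions x) (perms xs)

-- S_n as the list of all words w = w₁⋯wₙ that are permutations of 1..n
-- (each permutation appears exactly once).
Sn : ℕ → List (List ℕ)
Sn n = perms (applyUpTo suc n)

-- Schensted insertion (French notation: tableau = list of rows,
-- bottom row first, each row increasing left to right).

Tableau : Set
Tableau = List (List ℕ)

insertRow : ℕ → List ℕ → List ℕ × Maybe ℕ
insertRow x []       = (x ∷ [] , nothing)
insertRow x (y ∷ ys) with x <ᵇ y
... | true  = (x ∷ ys , just y)
... | false with insertRow x ys
...   | (r , b) = (y ∷ r , b)

insertT : ℕ → Tableau → Tableau × ℕ
insertT x []       = ((x ∷ []) ∷ [] , 0)
insertT x (r ∷ rs) with insertRow x r
... | (r' , nothing) = (r' ∷ rs , 0)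
... | (r' , just y) with insertT y rs
...   | (rs' , k) = (r' ∷ rs' , suc k)

addAt : ℕ → ℕ → Tableau → Tableau
addAt i zero    []       = (i ∷ []) ∷ []
addAt i zero    (r ∷ rs) = (r ++ (i ∷ [])) ∷ rs
addAt i (suc k) []       = (i ∷ []) ∷ []
addAt i (suc k) (r ∷ rs) = r ∷ addAt i k rs

rskFrom : ℕ → List ℕ → Tableau × Tableau → Tableau × Tableau
rskFrom i []       PQ = PQ
rskFrom i (x ∷ xs) (P , Q) with insertT x P
... | (P' , k) = rskFrom (suc i) xs (P' , addAt i k Q)

RSK : List ℕ → Tableau × Tableau
RSK w = rskFrom 1 w ([] , [])

-- Columns of a tableau (entries read bottom to top, i.e. increasing).

nth : List ℕ → ℕ → Maybe ℕ
nth []       _       = nothing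
nth (x ∷ _)  zero    = just x
nth (_ ∷ xs) (suc j) = nth xs j

column : Tableau → ℕ → List ℕ
column []       j = []
column (r ∷ rs) j with nth r j
... | just x  = x ∷ column rs j
... | nothing = column rs j

firstRowLength : Tableau → ℕ
firstRowLength []      = 0
firstRowLength (r ∷ _) = length r

columns : Tableau → List (List ℕ)
columns T = map (column T) (upTo (firstRowLength T))

-- Polynomials in the commuting indeterminates z_{i,j} with integer
-- coefficients, as formal sums of terms c · (product of z_{i,j}).
-- A monomial is a list of index pairs (i , j) (a multiset; order
-- irrelevant since the variables commute).

Monomial : Set
Monomial = List (ℕ × ℕ)

Poly : Set
Poly = List (ℤ × Monomial)

onePoly : Poly
onePoly = (1ℤ , []) ∷ []

_*P_ : Poly → Poly → Poly
p *P q = concatMap (λ t → map (λ s → (proj₁ t ℤ.* proj₁ s , proj₂ t ++ proj₂ s)) q) p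

prodP : List Poly → Poly
prodP = foldr _*P_ onePoly

countLess : ℕ → List ℕ → ℕ
countLess x []       = 0
countLess x (y ∷ ys) = (if y <ᵇ x then 1 else 0) + countLess x ys

inversions : List ℕ → ℕ
inversions []       = 0
inversions (x ∷ xs) = countLess x xs + inversions xs

signPow : ℕ → ℤ
signPow zero    = 1ℤ
signPow (suc k) = - signPow k

-- Leibniz determinant of the submatrix of (z_{i,k}) with rows R and
-- columns C (both increasing lists of the same length):
--   Σ_{ρ ordering of C} sgn(ρ) ∏_t z_{R_t , ρ_t}.
det : List ℕ → List ℕ → Poly
det R C = map (λ ρ → (signPow (inversions ρ) , zip R ρ)) (perms C)

bitableau : Tableau → Tableau → Poly
bitableau P Q = prodP (zipDets (columns P) (columns Q))
  where
  zipDets : List (List ℕ) → List (List ℕ) → List Poly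
  zipDets (a ∷ as) (b ∷ bs) = det a b ∷ zipDets as bs
  zipDets _        _        = []

eqPair : ℕ × ℕ → ℕ × ℕ → Bool
eqPair (a , b) (c , d) = (a ≡ᵇ c) ∧ (b ≡ᵇ d)

countPair : ℕ × ℕ → Monomial → ℕ
countPair p []       = 0
countPair p (q ∷ qs) = (if eqPair p q then 1 else 0) + countPair p qs

allB : (ℕ × ℕ → Bool) → Monomial → Bool
allB f []       = true
allB f (x ∷ xs) = f x ∧ allB f xs

sameMonomial : Monomial → Monomial → Bool
sameMonomial m m' = allB (λ p → countPair p m ≡ᵇ countPair p m') (m ++ m')

coeff : Monomial → Poly → ℤ
coeff m []             = 0ℤ
coeff m ((c , m') ∷ p) = (if sameMonomial m m' then c else 0ℤ) ℤ.+ coeff m p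

zMonomial : List ℕ → Monomial
zMonomial w = zip w (applyUpTo suc (length w))

coeffAlpha : List ℕ → ℤ
coeffAlpha w = coeff (zMonomial w) (bitableau (proj₁ (RSK w)) (proj₂ (RSK w)))

isZero : ℤ → Bool
isZero (+ zero) = true
isZero _        = false

countB : (List ℕ → Bool) → List (List ℕ) → ℕ
countB f []       = 0
countB f (x ∷ xs) = (if f x then 1 else 0) + countB f xs

cardC : ℕ → ℕ
cardC n = countB (λ w → isZero (coeffAlpha w)) (Sn n)

ratio : ℕ → ℚ
ratio n = (+ cardC n) / (n !)
  where instance _ = n !≢0

{-# OPTIONS --safe #-}
-- If the coefficient of z^α is nonzero, then w = w_α maps the first column of Q_α onto the first column
-- of P_α. Running Schensted insertion, this forces every step that creates a new row to insert a
-- left-to-right minimum of w, so P_α has exactly as many rows as w has left-to-right minima. Since the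
-- first row of P_α is at most as long as some increasing subsequence, n ≤ minima(w) · lis(w).
-- For a random w this is unlikely: the mean of 2^minima(w) is n + 1, so minima(w) exceeds log₂ n by
-- a large constant with small probability, and the expected number of increasing subsequences of
-- length k is C(n,k)/k! ≤ n^k/(k!)², which is small for k of order n^(2/3).
module Submission where

open import Defs
open import Data.Bool using (Bool; true; false; T; if_then_else_; not)
open import Data.Bool.Properties using (T-≡; T-∧)
open import Data.Empty using (⊥-elim)
open import Data.Integer as ℤ using (0ℤ)
import Data.Integer.Properties as ℤ
open import Data.List using (List; []; _∷_; _++_; [_]; map; concat; concatMap; length; zip; take; reverse; _ʳ++_; fromMaybe; applyUpTo; applyDownFrom)
open import Data.List.Properties using (length-++; length-map; length-take; length-reverse; length-applyUpTo; length-applyDownFrom; ∷-injectiveˡ; ∷-injectiveʳ; map-++; map-∘; reverse-involutive; reverse-applyUpTo)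
open import Data.List.Membership.Propositional using (_∈_; _∉_)
open import Data.List.Membership.Propositional.Properties using (∈-concat⁻′; ∈-map⁻; ∈-++⁺ˡ; ∈-++⁺ʳ)
open import Data.List.Relation.Unary.All as All using (All; []; _∷_)
import Data.List.Relation.Unary.All.Properties as All
open import Data.List.Relation.Unary.AllPairs using (AllPairs; []; _∷_)
open import Data.List.Relation.Unary.Any using (here; there)
open import Data.List.Relation.Unary.Unique.Propositional using (Unique)
open import Data.List.Relation.Unary.Unique.Propositional.Properties using (applyUpTo⁺₁)
open import Data.List.Relation.Binary.Permutation.Propositional as Perm using (_↭_; refl; prep; swap; ↭-refl; ↭-sym; ↭-trans; ↭⇒↭ₛ)
open import Data.List.Relation.Binary.Permutation.Propositional.Properties using (∈-resp-↭; All-resp-↭; ↭-length; shift; ++⁺ʳ; ++⁺ˡ; ↭-reverse)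
import Data.List.Relation.Binary.Permutation.Setoid.Properties as Permutationₛ
open import Data.List.Relation.Binary.Sublist.Heterogeneous.Properties using (length-mono-≤; take-Sublist; reverse⁺; ∷ˡ⁻)
open import Data.List.Relation.Binary.Sublist.Propositional using (_⊆_; []; _∷_; _∷ʳ_; minimum; lookup)
open import Data.List.Relation.Binary.Sublist.Propositional.Properties using (All-resp-⊆)
open import Data.Maybe using (Maybe; just; nothing)
open import Data.Nat hiding (∣_-_∣)
open import Data.Nat.Coprimality using (Coprime)
open import Data.Nat.ListAction using (sum)
open import Data.Nat.ListAction.Properties using (sum-++)
open import Data.Nat.Properties
open import Data.Nat.Tactic.RingSolver using (solve-∀)
open import Data.List.Relation.Binary.Sublist.DecPropositional _≟_ using (_⊆?_)
open import Data.Product using (∃; ∃₂; _×_; _,_; proj₁; proj₂)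
open import Data.Rational as ℚ using (ℚ; mkℚ; 0ℚ; 1ℚ; _-_; ∣_∣)
import Data.Rational.Properties as ℚ
import Data.Rational.Unnormalised as ℚᵘ
import Data.Rational.Unnormalised.Properties as ℚᵘ
open import Data.Sum using (_⊎_; inj₁; inj₂; [_,_]′)
open import Data.Unit using (⊤; tt)
open import Function using (_∘_)
open import Function.Bundles using (Equivalence)
open import Relation.Binary.PropositionalEquality as ≡ using (_≡_; _≢_; refl; sym; cong; cong₂; subst; setoid)
open import Relation.Nullary using (¬_; yes; no; does; contradiction)

-- Why the first columns correspond: the determinant of the first column is a factor of the
-- bitableau, and each of its terms has, for every j in the first column of Q, a variable with
-- second index j whose first index lies in the first column of P. In z^α the only variable with
-- second index j has first index w_j. A nonzero coefficient enters solely through the existence of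
-- one term whose monomial is z^α. The letters already inserted are kept in reverse order, so
-- increasing subsequences of w appear as decreasing sublists of `reverse w`. The exponent 2/3 comes
-- from the crude estimate (4m)! ≥ m^(3m): with k = 4m it reduces n^k ≤ (k!)² to n^4 ≤ m^6. This
-- leaves room of order n^(1/3) for the number of minima, while a logarithm suffices. Probabilities
-- are multiplied out into inequalities between natural numbers; rationals enter only at the very
-- end.

-- Schensted insertion

perms-↭ : ∀ xs {ρ} → ρ ∈ perms xs → ρ ↭ xs
perms-↭ []       (here refl) = ↭-refl
perms-↭ (x ∷ xs) ρ∈ with ∈-concat⁻′ _ ρ∈
... | us , ρ∈us , us∈ with ∈-map⁻ (insertions x) us∈
...   | w , w∈ , refl = ↭-trans (insertions-↭ w ρ∈us) (prep x (perms-↭ xs w∈))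
  where
  insertions-↭ : ∀ w {u} → u ∈ insertions x w → u ↭ x ∷ w
  insertions-↭ []       (here refl) = ↭-refl
  insertions-↭ (y ∷ ys) (here refl) = ↭-refl
  insertions-↭ (y ∷ ys) (there u∈) with ∈-map⁻ (y ∷_) u∈
  ... | v , v∈ , refl = ↭-trans (prep y (insertions-↭ ys v∈)) (swap y x ↭-refl)

data RowIns : ℕ → List ℕ → List ℕ → Maybe ℕ → Set where
  append : ∀ {x} → RowIns x [] (x ∷ []) nothing
  bump   : ∀ {x y ys} → x < y → RowIns x (y ∷ ys) (x ∷ ys) (just y)
  skip   : ∀ {x y ys zs b} → y ≤ x → RowIns x ys zs b → RowIns x (y ∷ ys) (y ∷ zs) b

data TabIns : ℕ → Tableau → Tableau → ℕ → Set where
  new  : ∀ {x} → TabIns x [] ((x ∷ []) ∷ []) 0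
  done : ∀ {x r r′ rs} → RowIns x r r′ nothing → TabIns x (r ∷ rs) (r′ ∷ rs) 0
  up   : ∀ {x y r r′ rs rs′ k} → RowIns x r r′ (just y) → TabIns y rs rs′ k →
         TabIns x (r ∷ rs) (r′ ∷ rs′) (suc k)

rowIns : ∀ x r → RowIns x r (proj₁ (insertRow x r)) (proj₂ (insertRow x r))
rowIns x []       = append
rowIns x (y ∷ ys) with x <ᵇ y in eq
... | true  = bump (<ᵇ⇒< x y (subst T (sym eq) tt))
... | false with insertRow x ys | rowIns x ys
...   | _ , _ | p = skip (≮⇒≥ λ x<y → subst T eq (<⇒<ᵇ x<y)) p

tabIns : ∀ x P → TabIns x P (proj₁ (insertT x P)) (proj₂ (insertT x P))
tabIns x []       = new
tabIns x (r ∷ rs) with insertRow x r | rowIns x r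
... | _ , nothing | p = done p
... | _ , just y  | p with insertT y rs | tabIns y rs
...   | _ , _ | q = up p q

rskFrom-∷ : ∀ i x xs P Q → rskFrom i (x ∷ xs) (P , Q) ≡
            rskFrom (suc i) xs (proj₁ (insertT x P) , addAt i (proj₂ (insertT x P)) Q)
rskFrom-∷ i x xs P Q with insertT x P
... | _ , _ = refl

-- First columns, shapes and column-strictness under insertion

heads : Tableau → List ℕ
heads T = column T 0

heads-⊆-concat : ∀ T {a} → a ∈ heads T → a ∈ concat T
heads-⊆-concat ([] ∷ rs)      a∈          = heads-⊆-concat rs a∈
heads-⊆-concat ((h ∷ r) ∷ rs) (here refl) = here refl
heads-⊆-concat ((h ∷ r) ∷ rs) (there a∈)  = there (∈-++⁺ʳ r (heads-⊆-concat rs a∈))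

-- The row s fits on top of the row r in a standard tableau.
data _◂_ : List ℕ → List ℕ → Set where
  []  : ∀ {r} → r ◂ []
  _∷_ : ∀ {a b r s} → a < b → r ◂ s → (a ∷ r) ◂ (b ∷ s)

-- Rows are required to be nonempty, so that `heads` has exactly one entry per row.
data Stack : List ℕ → Tableau → Set where
  []  : ∀ {r} → Stack r []
  _∷_ : ∀ {r b s T} → r ◂ (b ∷ s) → Stack (b ∷ s) T → Stack r ((b ∷ s) ∷ T)

bump-> : ∀ {x y r r′} → RowIns x r r′ (just y) → x < y
bump-> (bump x<y) = x<y
bump-> (skip _ p) = bump-> p

bump-∈ : ∀ {x y r r′} → RowIns x r r′ (just y) → y ∈ r
bump-∈ (bump _)   = here refl
bump-∈ (skip _ p) = there (bump-∈ p)

◂-lower : ∀ {x r r′ s b} → RowIns x r r′ b → r ◂ s → r′ ◂ s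
◂-lower p          []          = []
◂-lower (bump x<y) (y<b ∷ r◂s) = <-trans x<y y<b ∷ r◂s
◂-lower (skip _ p) (y<b ∷ r◂s) = y<b ∷ ◂-lower p r◂s

-- A bumped entry moves weakly to the left: y is smaller than the entry above its old place, so it
-- cannot be inserted further right than that. Every entry that ends up below y is then at most x,
-- hence smaller than y.
◂-insert : ∀ {x y r r′ s s′ b} → RowIns x r r′ (just y) → RowIns y s s′ b → r ◂ s → r′ ◂ s′
◂-insert (bump x<y)   append     []          = x<y ∷ []
◂-insert (bump x<y)   (bump _)   (_ ∷ r◂s)   = x<y ∷ r◂s
◂-insert (bump x<y)   (skip b≤y _) (y<b ∷ _) = contradiction b≤y (<⇒≱ y<b)
◂-insert (skip a≤x p) append     []          = ≤-<-trans a≤x (bump-> p) ∷ []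
◂-insert (skip a≤x p) (bump _)   (_ ∷ r◂s)   = ≤-<-trans a≤x (bump-> p) ∷ ◂-lower p r◂s
◂-insert (skip a≤x p) (skip _ q) (a<b ∷ r◂s) = a<b ∷ ◂-insert p q r◂s

Stack-lower : ∀ {x r r′ b T} → RowIns x r r′ b → Stack r T → Stack r′ T
Stack-lower p []        = []
Stack-lower p (r◂s ∷ t) = ◂-lower p r◂s ∷ t

Stack-insert : ∀ {x y r r′ T T′ k} → RowIns x r r′ (just y) → TabIns y T T′ k →
               Stack r T → Stack r′ T′
Stack-insert p new                 []        = ◂-insert p append [] ∷ []
Stack-insert p (done q@(skip _ _)) (r◂s ∷ t) = ◂-insert p q r◂s ∷ Stack-lower q t
Stack-insert p (up q@(bump _)   t′) (r◂s ∷ t) = ◂-insert p q r◂s ∷ Stack-insert q t′ t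
Stack-insert p (up q@(skip _ _) t′) (r◂s ∷ t) = ◂-insert p q r◂s ∷ Stack-insert q t′ t

◂-length : ∀ {r s} → r ◂ s → length s ≤ length r
◂-length []        = z≤n
◂-length (_ ∷ r◂s) = s≤s (◂-length r◂s)

Stack-size : ∀ {r T} → Stack r T → length (concat T) ≤ length (heads T) * length r
Stack-size []                          = z≤n
Stack-size {r} (_∷_ {b = b} {s} {T} r◂s t) = begin
  length ((b ∷ s) ++ concat T)                         ≡⟨ length-++ (b ∷ s) ⟩
  length (b ∷ s) + length (concat T)                   ≤⟨ +-mono-≤ (◂-length r◂s)
     (≤-trans (Stack-size t) (*-monoʳ-≤ (length (heads T)) (◂-length r◂s))) ⟩
  length r + length (heads T) * length r               ∎
  where open ≤-Reasoning

rowIns-↭ : ∀ {x r r′ b} → RowIns x r r′ b → fromMaybe b ++ r′ ↭ x ∷ r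
rowIns-↭ append = ↭-refl
rowIns-↭ (bump {x} {y} _) = swap y x ↭-refl
rowIns-↭ (skip {x} {y} {b = nothing} _ p) = ↭-trans (prep y (rowIns-↭ p)) (swap y x ↭-refl)
rowIns-↭ (skip {x} {y} {b = just z} _ p)  =
  ↭-trans (swap z y ↭-refl) (↭-trans (prep y (rowIns-↭ p)) (swap y x ↭-refl))

tabIns-↭ : ∀ {x P P′ k} → TabIns x P P′ k → concat P′ ↭ x ∷ concat P
tabIns-↭ new                  = ↭-refl
tabIns-↭ (done {rs = rs} p)   = ++⁺ʳ (concat rs) (rowIns-↭ p)
tabIns-↭ (up {y = y} {r′ = r′} {rs} p q) =
  ↭-trans (++⁺ˡ r′ (tabIns-↭ q)) (↭-trans (shift y r′ (concat rs)) (++⁺ʳ (concat rs) (rowIns-↭ p)))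

rowIns-length : ∀ {x r r′ b} → RowIns x r r′ b →
                length (fromMaybe b) + length r′ ≡ suc (length r)
rowIns-length {b = b} p = ≡.trans (sym (length-++ (fromMaybe b))) (↭-length (rowIns-↭ p))

sameShape-insert : ∀ {x P P′ k} i Q → TabIns x P P′ k → map length P ≡ map length Q →
                   map length P′ ≡ map length (addAt i k Q)
sameShape-insert i []       new      _  = refl
sameShape-insert i (q ∷ qs) (done p) eq =
  cong₂ _∷_ (≡.trans (rowIns-length p) (≡.trans (cong suc (∷-injectiveˡ eq)) (sym (length-∷ʳ q))))
            (∷-injectiveʳ eq)
  where
  length-∷ʳ : ∀ (q : List ℕ) → length (q ++ i ∷ []) ≡ suc (length q)
  length-∷ʳ q = ≡.trans (length-++ q) (+-comm _ 1)
sameShape-insert i (q ∷ qs) (up p t) eq =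
  cong₂ _∷_ (≡.trans (suc-injective (rowIns-length p)) (∷-injectiveˡ eq))
            (sameShape-insert i qs t (∷-injectiveʳ eq))

heads-addAt : ∀ i k Q {a} → a ∈ heads Q → a ∈ heads (addAt i k Q)
heads-addAt i zero    ([] ∷ rs)      a∈          = there a∈
heads-addAt i zero    ((h ∷ r) ∷ rs) a∈          = a∈
heads-addAt i (suc k) ([] ∷ rs)      a∈          = heads-addAt i k rs a∈
heads-addAt i (suc k) ((h ∷ r) ∷ rs) (here refl) = here refl
heads-addAt i (suc k) ((h ∷ r) ∷ rs) (there a∈)  = there (heads-addAt i k rs a∈)

heads-rskFrom : ∀ i xs P Q {a} → a ∈ heads Q → a ∈ heads (proj₂ (rskFrom i xs (P , Q)))
heads-rskFrom i []       P Q a∈ = a∈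
heads-rskFrom i (x ∷ xs) P Q a∈ rewrite rskFrom-∷ i x xs P Q =
  heads-rskFrom (suc i) xs _ _ (heads-addAt i (proj₂ (insertT x P)) Q a∈)

∈-heads-newRow : ∀ i Q → i ∈ heads (addAt i (length Q) Q)
∈-heads-newRow i []             = here refl
∈-heads-newRow i ([] ∷ rs)      = ∈-heads-newRow i rs
∈-heads-newRow i ((h ∷ r) ∷ rs) = there (∈-heads-newRow i rs)

-- a is the smallest entry of a decreasing list of j + 1 entries of u.
End : List ℕ → ℕ → ℕ → Set
End u j a = ∃ λ s → a ∷ s ⊆ u × AllPairs _>_ (a ∷ s) × length s ≡ j

-- Half of Schensted's theorem: with `u` the letters read so far in reverse, the entry of the first
-- row at position j (from 0) ends an increasing subsequence of length j + 1.
Ends : List ℕ → ℕ → List ℕ → Set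
Ends u j []      = ⊤
Ends u j (a ∷ r) = End u j a × Ends u (suc j) r

Ends-weaken : ∀ {u j} x r → Ends u j r → Ends (x ∷ u) j r
Ends-weaken x []      _                  = tt
Ends-weaken x (a ∷ r) ((s , p , q) , es) = (s , x ∷ʳ p , q) , Ends-weaken x r es

-- Each entry y that x passes supplies a subsequence which x prolongs, so x arrives at its place
-- with one of the right length. Passing gives only y ≤ x; strictness comes from x being a new
-- letter.
Ends-insert : ∀ {x u j r r′ b} → RowIns x r r′ b → x ∉ u → Ends u j r →
              End (x ∷ u) j x → Ends (x ∷ u) j r′
Ends-insert append                 x∉u _        e = e , tt
Ends-insert (bump {ys = ys} _)     x∉u (_ , es) e = e , Ends-weaken _ ys es
Ends-insert {x} (skip {y = y} y≤x p) x∉u ((s , y∷s⊆u , q@(y>s ∷ _) , eq) , es) _ =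
  (s , x ∷ʳ y∷s⊆u , q , eq) ,
  Ends-insert p x∉u es (y ∷ s , refl ∷ y∷s⊆u , (x>y ∷ All.map (λ y>a → <-trans y>a x>y) y>s) ∷ q , cong suc eq)
  where
  x>y : x > y
  x>y = ≤∧≢⇒< y≤x λ { refl → x∉u (lookup y∷s⊆u (here refl)) }

Ends-last : ∀ {u} j a r → Ends u j (a ∷ r) →
            ∃ λ s → s ⊆ u × AllPairs _>_ s × length s ≡ j + length (a ∷ r)
Ends-last j a []      ((s , p , q , eq) , _) = a ∷ s , p , q , ≡.trans (cong suc eq) (+-comm 1 j)
Ends-last j a (b ∷ r) (_ , es) with Ends-last (suc j) b r es
... | s , p , q , eq = s , p , q , ≡.trans eq (sym (+-suc j _))

-- One insertion step and its effect on the first column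

data Inv (u : List ℕ) : ℕ → Tableau → Tableau → Set where
  inv : ∀ {h r rs Q} → Stack (h ∷ r) rs → concat ((h ∷ r) ∷ rs) ↭ u →
        map length ((h ∷ r) ∷ rs) ≡ map length Q → Ends u 0 (h ∷ r) →
        Inv u h ((h ∷ r) ∷ rs) Q

-- The corner entry h is the running minimum of the letters read, so x < h says that x is a
-- left-to-right minimum. In `grow` a new row appears although x has settled in the first row to the
-- right of h; this is the case that a nonzero coefficient excludes.
data Step (x h : ℕ) (P P′ : Tableau) (k : ℕ) : ℕ → Set where
  minimal : x < h → heads P′ ≡ x ∷ heads P → k ≡ length P → Step x h P P′ k x
  grow    : h ≤ x → x ∉ heads P′ → k ≡ length P → Step x h P P′ k h
  stay    : h ≤ x → heads P′ ≡ heads P → Step x h P P′ k h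

-- The first column increases upwards, so a head that is bumped out is smaller than the head above
-- and bumps it in turn. The whole column moves up by one and the last head opens a new row.
heads-bumpAll : ∀ {x h r rs P′ k} → x < h → TabIns x ((h ∷ r) ∷ rs) P′ k → Stack (h ∷ r) rs →
                heads P′ ≡ x ∷ h ∷ heads rs × k ≡ suc (length rs)
heads-bumpAll x<h (done (skip h≤x _)) _ = contradiction h≤x (<⇒≱ x<h)
heads-bumpAll x<h (up (skip h≤x _) _) _ = contradiction h≤x (<⇒≱ x<h)
heads-bumpAll x<h (up (bump _) new)   _ = refl , refl
heads-bumpAll x<h (up (bump _) t@(done _)) ((h<b ∷ _) ∷ st) with heads-bumpAll h<b t st
... | eq , eq′ = cong (_ ∷_) eq , cong suc eq′
heads-bumpAll x<h (up (bump _) t@(up _ _)) ((h<b ∷ _) ∷ st) with heads-bumpAll h<b t st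
... | eq , eq′ = cong (_ ∷_) eq , cong suc eq′

-- Either the bumping path never meets the first column, or from the first head that it meets it
-- stays in that column up to the top, as in `heads-bumpAll`.
heads-insert : ∀ {x r T T′ k} → TabIns x T T′ k → Stack r T → k ≡ length T ⊎ heads T′ ≡ heads T
heads-insert new _ = inj₁ refl
heads-insert (done (skip _ _)) _ = inj₂ refl
heads-insert t@(up (bump x<y) _) (_ ∷ st) = inj₁ (proj₂ (heads-bumpAll x<y t st))
heads-insert (up (skip _ p) t) (_ ∷ st) with heads-insert t st
... | inj₁ eq = inj₁ (cong suc eq)
... | inj₂ eq = inj₂ (cong (_ ∷_) eq)

End-singleton : ∀ {u} x → End (x ∷ u) 0 x
End-singleton x = [] , refl ∷ minimum _ , [] ∷ [] , refl

step : ∀ {u x h P P′ Q k} i → Inv u h P Q → x ∉ u → TabIns x P P′ k →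
       ∃ λ h′ → Inv (x ∷ u) h′ P′ (addAt i k Q) × Step x h P P′ k h′
step {x = x} {h} {Q = Q} i (inv st perm sh es) x∉u t with t
... | done p@(skip h≤x _) =
  h , inv (Stack-lower p st) (↭-trans (tabIns-↭ t) (prep x perm)) (sameShape-insert i Q t sh)
          (Ends-insert p x∉u es (End-singleton x))
    , stay h≤x refl
... | up p@(bump x<h) t′ =
  x , inv (Stack-insert p t′ st) (↭-trans (tabIns-↭ t) (prep x perm)) (sameShape-insert i Q t sh)
          (Ends-insert p x∉u es (End-singleton x))
    , minimal x<h (proj₁ all) (proj₂ all)
  where all = heads-bumpAll x<h t st
... | up {rs = rs} {rs′} p@(skip {ys = r} {zs = r′} h≤x p′) t′ =
  h , inv (Stack-insert p t′ st) (↭-trans (tabIns-↭ t) (prep x perm)) (sameShape-insert i Q t sh)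
          (Ends-insert p x∉u es (End-singleton x))
    , result (heads-insert t′ st)
  where
  x∉P : x ∉ concat ((h ∷ r) ∷ rs)
  x∉P x∈ = x∉u (∈-resp-↭ perm x∈)
  x∉heads : x ∉ heads ((h ∷ r′) ∷ rs′)
  x∉heads (here refl) = x∉P (here refl)
  x∉heads (there x∈)  with ∈-resp-↭ (tabIns-↭ t′) (heads-⊆-concat rs′ x∈)
  ... | here refl = x∉P (there (∈-++⁺ˡ (bump-∈ p′)))
  ... | there x∈′ = x∉P (there (∈-++⁺ʳ r x∈′))
  result : _ ⊎ _ → Step _ _ _ _ _ _
  result (inj₁ eq) = grow h≤x x∉heads (cong suc eq)
  result (inj₂ eq) = stay h≤x (cong (h ∷_) eq)

-- Left-to-right minima and the number of rows

-- The number of left-to-right minima of w that are smaller than b.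
minima : ℕ → List ℕ → ℕ
minima b []      = 0
minima b (x ∷ w) = if x <ᵇ b then suc (minima x w) else minima b w

minima-< : ∀ {x b} w → x < b → minima b (x ∷ w) ≡ suc (minima x w)
minima-< {x} {b} w x<b rewrite Equivalence.to T-≡ (<⇒<ᵇ x<b) = refl

minima-≥ : ∀ {x b} w → b ≤ x → minima b (x ∷ w) ≡ minima b w
minima-≥ {x} {b} w b≤x with x <ᵇ b in eq
... | true  = contradiction b≤x (<⇒≱ (<ᵇ⇒< x b (subst T (sym eq) tt)))
... | false = refl

zipFrom : ℕ → List ℕ → List (ℕ × ℕ)
zipFrom i []       = []
zipFrom i (x ∷ xs) = (x , i) ∷ zipFrom (suc i) xs

∉-∷⁺ : ∀ {x xs} {u : List ℕ} → All (x ≢_) xs → All (_∉ u) xs → All (_∉ (x ∷ u)) xs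
∉-∷⁺ []         []         = []
∉-∷⁺ (x≢y ∷ ps) (y∉u ∷ qs) = (λ { (here eq) → x≢y (sym eq) ; (there y∈) → y∉u y∈ }) ∷ ∉-∷⁺ ps qs

Inv-rskFrom : ∀ {u h P Q} i xs → Inv u h P Q → Unique xs → All (_∉ u) xs →
              ∃ λ h′ → Inv (xs ʳ++ u) h′ (proj₁ (rskFrom i xs (P , Q))) (proj₂ (rskFrom i xs (P , Q)))
Inv-rskFrom i [] I _ _ = _ , I
Inv-rskFrom {P = P} {Q} i (x ∷ xs) I (x≢ ∷ uniq) (x∉u ∷ xs∉u)
  rewrite rskFrom-∷ i x xs P Q with step i I x∉u (tabIns x P)
... | h′ , I′ , _ = Inv-rskFrom (suc i) xs I′ uniq (∉-∷⁺ x≢ xs∉u)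

-- If every step i that creates a new row has w_i in the final first column, then only left-to-right
-- minima create rows: any other such w_i is not in the first column right after its insertion, and
-- the later entries of that column are old ones or letters after w_i.
rows-minima : ∀ {u h P Q} i xs → Inv u h P Q → Unique xs → All (_∉ u) xs →
  let (P* , Q*) = rskFrom i xs (P , Q) in
  (∀ {x j} → (x , j) ∈ zipFrom i xs → j ∈ heads Q* → x ∈ heads P*) →
  length (heads P*) ≡ minima h xs + length (heads P) ×
  (∀ {a} → a ∈ heads P* → a ∈ heads P ⊎ a ∈ xs)
rows-minima i [] I _ _ _ = refl , inj₁
rows-minima {h = h} {P} {Q} i (x ∷ xs) I (x≢ ∷ uniq) (x∉u ∷ xs∉u) G
  rewrite rskFrom-∷ i x xs P Q with step i I x∉u (tabIns x P)
... | h′ , I′ , st with rows-minima (suc i) xs I′ uniq (∉-∷⁺ x≢ xs∉u) (G ∘ there) | st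
...   | count , old | minimal x<h eq _ rewrite eq | minima-< xs x<h =
  ≡.trans count (+-suc _ _) ,
  λ a∈ → [ (λ { (here refl) → inj₂ (here refl) ; (there a∈′) → inj₁ a∈′ }) , inj₂ ∘ there ]′ (old a∈)
...   | count , old | stay h≤x eq rewrite eq | minima-≥ xs h≤x =
  count , λ a∈ → [ inj₁ , inj₂ ∘ there ]′ (old a∈)
...   | count , old | grow _ x∉heads k≡ =
  ⊥-elim ([ x∉heads , (λ x∈ → All.lookup x≢ x∈ refl) ]′ (old (G (here refl) i∈)))
  where
  Inv-length : ∀ {u h P Q} → Inv u h P Q → length P ≡ length Q
  Inv-length {P = P} {Q} (inv _ _ sh _) =
    ≡.trans (sym (length-map length P)) (≡.trans (cong length sh) (length-map length Q))
  i∈ : i ∈ heads (proj₂ (rskFrom (suc i) xs (_ , _)))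
  i∈ = heads-rskFrom (suc i) xs _ _
         (subst (λ k → i ∈ heads (addAt i k Q)) (sym (≡.trans k≡ (Inv-length I))) (∈-heads-newRow i Q))

-- Terms of the bitableau and the first columns

coeff≢0⇒term : ∀ m p → coeff m p ≢ 0ℤ → ∃₂ λ c m′ → (c , m′) ∈ p × T (sameMonomial m m′)
coeff≢0⇒term m [] c≢0 = contradiction refl c≢0
coeff≢0⇒term m ((c , m′) ∷ p) c≢0 with sameMonomial m m′ in eq
... | true  = c , m′ , here refl , subst T (sym eq) tt
... | false with coeff≢0⇒term m p (λ z → c≢0 (≡.trans (ℤ.+-identityˡ _) z))
...   | c′ , m″ , t∈ , same = c′ , m″ , there t∈ , same

∈⇒countPair>0 : ∀ q {m} → q ∈ m → 0 < countPair q m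
∈⇒countPair>0 (a , b) (here refl)
  rewrite Equivalence.to T-≡ (≡⇒≡ᵇ a a refl) | Equivalence.to T-≡ (≡⇒≡ᵇ b b refl) = z<s
∈⇒countPair>0 q {q′ ∷ m} (there q∈) = <-≤-trans (∈⇒countPair>0 q q∈) (m≤n+m _ _)

countPair>0⇒∈ : ∀ q m → 0 < countPair q m → q ∈ m
countPair>0⇒∈ (a , b) ((c , d) ∷ m) pos with a ≡ᵇ c in a≡c | b ≡ᵇ d in b≡d
... | true  | true  rewrite ≡ᵇ⇒≡ a c (subst T (sym a≡c) tt) | ≡ᵇ⇒≡ b d (subst T (sym b≡d) tt) = here refl
... | true  | false = there (countPair>0⇒∈ (a , b) m pos)
... | false | _     = there (countPair>0⇒∈ (a , b) m pos)

allB-lookup : ∀ f {q m} → T (allB f m) → q ∈ m → T (f q)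
allB-lookup f ok (here refl) = proj₁ (Equivalence.to T-∧ ok)
allB-lookup f {m = q′ ∷ m} ok (there q∈) = allB-lookup f (proj₂ (Equivalence.to (T-∧ {f q′}) ok)) q∈

sameMonomial-∈ : ∀ m m′ {q} → T (sameMonomial m m′) → q ∈ m′ → q ∈ m
sameMonomial-∈ m m′ {q} same q∈ = countPair>0⇒∈ q m
  (subst (0 <_) (sym (≡ᵇ⇒≡ _ _ (allB-lookup (λ q → countPair q m ≡ᵇ countPair q m′) same (∈-++⁺ʳ m q∈))))
         (∈⇒countPair>0 q q∈))

-- The length condition keeps `zip` from cutting off the entry i of ρ.
∈-zip : ∀ (R : List ℕ) {ρ : List ℕ} {i} → length ρ ≤ length R → i ∈ ρ → ∃ λ a → a ∈ R × (a , i) ∈ zip R ρ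
∈-zip (a ∷ R) le       (here refl) = a , here refl , here refl
∈-zip (a ∷ R) (s≤s le) (there i∈) with ∈-zip R le i∈
... | b , b∈ , bi∈ = b , there b∈ , there bi∈

∈-*P : ∀ p q {t} → t ∈ p *P q → ∃₂ λ d s → d ∈ p × proj₂ t ≡ proj₂ d ++ proj₂ s
∈-*P p q t∈ with ∈-concat⁻′ _ t∈
... | ts , t∈ts , ts∈ with ∈-map⁻ (λ t → map (λ s → (proj₁ t ℤ.* proj₁ s , proj₂ t ++ proj₂ s)) q) ts∈
...   | d , d∈ , refl with ∈-map⁻ (λ s → (proj₁ d ℤ.* proj₁ s , proj₂ d ++ proj₂ s)) t∈ts
...     | s , _ , refl = d , s , d∈ , refl

det-factor : ∀ m R C q {i} → coeff m (det R C *P q) ≢ 0ℤ → length C ≤ length R → i ∈ C →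
             ∃ λ a → a ∈ R × (a , i) ∈ m
det-factor m R C q c≢0 le i∈ with coeff≢0⇒term m (det R C *P q) c≢0
... | c , m′ , t∈ , same with ∈-*P (det R C) q t∈
...   | d , s , d∈ , refl with ∈-map⁻ (λ ρ → (signPow (inversions ρ) , zip R ρ)) d∈
...     | ρ , ρ∈ , refl with perms-↭ C ρ∈
...       | ρ↭C with ∈-zip R (subst (_≤ length R) (sym (↭-length ρ↭C)) le) (∈-resp-↭ (↭-sym ρ↭C) i∈)
...         | a , a∈ , ai∈ = a , a∈ , sameMonomial-∈ m _ same (∈-++⁺ˡ ai∈)

bitableau-column : ∀ m P Q {i} → coeff m (bitableau P Q) ≢ 0ℤ → map length P ≡ map length Q →
                   0 < firstRowLength P → length (heads Q) ≤ length (heads P) → i ∈ heads Q →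
                   ∃ λ a → a ∈ heads P × (a , i) ∈ m
bitableau-column m ((h ∷ r) ∷ P) ((h′ ∷ r′) ∷ Q) c≢0 _ _ le i∈ =
  det-factor m (heads ((h ∷ r) ∷ P)) (heads ((h′ ∷ r′) ∷ Q)) _ c≢0 le i∈

zip-applyUpTo : ∀ i w f → (∀ k → f k ≡ k + i) → zip w (applyUpTo f (length w)) ≡ zipFrom i w
zip-applyUpTo i []      f f≡ = refl
zip-applyUpTo i (x ∷ w) f f≡ =
  cong₂ _∷_ (cong (x ,_) (f≡ 0))
            (zip-applyUpTo (suc i) w (f ∘ suc) (λ k → ≡.trans (f≡ (suc k)) (sym (+-suc k i))))

zipFrom-≥ : ∀ i w {x j} → (x , j) ∈ zipFrom i w → i ≤ j
zipFrom-≥ i (x ∷ w) (here refl) = ≤-refl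
zipFrom-≥ i (x ∷ w) (there p)   = <⇒≤ (zipFrom-≥ (suc i) w p)

zipFrom-functional : ∀ i w {x y j} → (x , j) ∈ zipFrom i w → (y , j) ∈ zipFrom i w → x ≡ y
zipFrom-functional i (x ∷ w) (here refl) (here refl) = refl
zipFrom-functional i (x ∷ w) (here refl) (there q)   = contradiction (zipFrom-≥ _ w q) 1+n≰n
zipFrom-functional i (x ∷ w) (there p)   (here refl) = contradiction (zipFrom-≥ _ w p) 1+n≰n
zipFrom-functional i (x ∷ w) (there p)   (there q)   = zipFrom-functional (suc i) w p q

heads-length : ∀ {r T} → Stack r T → length (heads T) ≡ length T
heads-length []       = refl
heads-length (_ ∷ st) = cong suc (heads-length st)

heads-length-≤ : ∀ (T : Tableau) → length (heads T) ≤ length T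
heads-length-≤ []            = z≤n
heads-length-≤ ([] ∷ T)      = m≤n⇒m≤1+n (heads-length-≤ T)
heads-length-≤ ((_ ∷ _) ∷ T) = s≤s (heads-length-≤ T)

-- P has n boxes, no row is longer than the first, and the first row is as long as some increasing
-- subsequence of w. The row count c is supplied under the condition that w respects the first
-- columns, and the nonzero coefficient provides that condition.
bitableau-size : ∀ {h P Q} w c → Inv (reverse w) h P Q → coeff (zMonomial w) (bitableau P Q) ≢ 0ℤ →
  ((∀ {x j} → (x , j) ∈ zipFrom 1 w → j ∈ heads Q → x ∈ heads P) → length (heads P) ≡ c) →
  ∃ λ s → s ⊆ reverse w × AllPairs _>_ s × length w ≤ c * length s
bitableau-size {h} {P} {Q} w c (inv {r = r} {rs} st perm sh es) c≢0 rows with Ends-last 0 h r es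
... | s , s⊆ , dec , len = s , s⊆ , dec , (begin
    length w                              ≡⟨ ↭-length (↭-reverse w) ⟨
    length (reverse w)                    ≡⟨ ↭-length perm ⟨
    length (concat P)                     ≡⟨ length-++ (h ∷ r) ⟩
    length (h ∷ r) + length (concat rs)   ≤⟨ +-monoʳ-≤ _ (Stack-size st) ⟩
    length (heads P) * length (h ∷ r)     ≡⟨ cong₂ _*_ (rows column-respected) (sym len) ⟩
    c * length s                          ∎)
  where
  open ≤-Reasoning
  heads-Q≤heads-P : length (heads Q) ≤ length (heads P)
  heads-Q≤heads-P = begin
    length (heads Q)        ≤⟨ heads-length-≤ Q ⟩
    length Q                ≡⟨ length-map length Q ⟨
    length (map length Q)   ≡⟨ cong length sh ⟨
    length (map length P)   ≡⟨ length-map length P ⟩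
    length P                ≡⟨ cong suc (heads-length st) ⟨
    length (heads P)        ∎
  column-respected : ∀ {x j} → (x , j) ∈ zipFrom 1 w → j ∈ heads Q → x ∈ heads P
  column-respected xj∈ j∈ with bitableau-column (zMonomial w) P Q c≢0 sh z<s heads-Q≤heads-P j∈
  ... | a , a∈ , aj∈
    -- z^α contains only one variable with second index j, so the factor found in the determinant is
    -- the one given by w.
    rewrite zipFrom-functional 1 w xj∈
              (subst ((a , _) ∈_) (zip-applyUpTo 1 w suc (λ k → sym (+-comm k 1))) aj∈) = a∈

coeffAlpha≢0⇒decreasing : ∀ b w → Unique w → All (_< b) w → coeffAlpha w ≢ 0ℤ →
  ∃ λ s → s ⊆ reverse w × AllPairs _>_ s × length w ≤ minima b w * length s
coeffAlpha≢0⇒decreasing b [] _ _ _ = [] , minimum _ , [] , z≤n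
coeffAlpha≢0⇒decreasing b (x ∷ w) (x≢ ∷ uniq) (x<b ∷ _) c≢0 =
  bitableau-size (x ∷ w) (minima b (x ∷ w)) (proj₂ (Inv-rskFrom 2 w I₁ uniq w∉[x])) c≢0
    (λ respected → ≡.trans (proj₁ (rows-minima 2 w I₁ uniq w∉[x] (respected ∘ there)))
                           (≡.trans (+-comm _ 1) (sym (minima-< w x<b))))
  where
  -- The invariant speaks of a nonempty tableau, so the run starts after the first letter, at step
  -- 2. That letter is itself a minimum, because x < b.
  I₁ : Inv (x ∷ []) x ((x ∷ []) ∷ []) ((1 ∷ []) ∷ [])
  I₁ = inv [] ↭-refl refl (End-singleton x , tt)
  w∉[x] : All (_∉ (x ∷ [])) w
  w∉[x] = ∉-∷⁺ x≢ (All.tabulate (λ _ ()))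

-- Sums over all words with given letters

sumIns : ℕ → (List ℕ → ℕ) → List ℕ → ℕ
sumIns x f []       = f [ x ]
sumIns x f (y ∷ ys) = f (x ∷ y ∷ ys) + sumIns x (f ∘ (y ∷_)) ys

-- The order in which letters are inserted is irrelevant for the sum over all words (sumPerms-↭), so
-- it can be adapted to the statistic: the largest letter last for left-to-right minima, the letters
-- outside S last for the words containing S.
sumPerms : List ℕ → (List ℕ → ℕ) → ℕ
sumPerms []       f = f []
sumPerms (x ∷ xs) f = sumPerms xs (sumIns x f)

sumIns-mono : ∀ x {f g} w → (∀ as bs → as ++ bs ≡ w → f (as ++ x ∷ bs) ≤ g (as ++ x ∷ bs)) →
              sumIns x f w ≤ sumIns x g w
sumIns-mono x []       le = le [] [] refl
sumIns-mono x (y ∷ ys) le =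
  +-mono-≤ (le [] (y ∷ ys) refl) (sumIns-mono x ys λ as bs eq → le (y ∷ as) bs (cong (y ∷_) eq))

sumIns-const : ∀ x c w → sumIns x (λ _ → c) w ≡ suc (length w) * c
sumIns-const x c []       = sym (+-identityʳ c)
sumIns-const x c (y ∷ ys) = cong (c +_) (sumIns-const x c ys)

sumIns-bound : ∀ x {f} c w → (∀ as bs → as ++ bs ≡ w → f (as ++ x ∷ bs) ≤ c) →
               sumIns x f w ≤ suc (length w) * c
sumIns-bound x c w le = ≤-trans (sumIns-mono x w le) (≤-reflexive (sumIns-const x c w))

sumIns-+ : ∀ x f g w → sumIns x (λ u → f u + g u) w ≡ sumIns x f w + sumIns x g w
sumIns-+ x f g []       = refl
sumIns-+ x f g (y ∷ ys) =
  ≡.trans (cong (f (x ∷ y ∷ ys) + g (x ∷ y ∷ ys) +_) (sumIns-+ x _ _ ys))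
          (+-+-swap (f (x ∷ y ∷ ys)) _ _ _)
  where
  +-+-swap : ∀ a b c d → (a + b) + (c + d) ≡ (a + c) + (b + d)
  +-+-swap = solve-∀

sumIns-comm : ∀ x y f w → sumIns x (sumIns y f) w ≡ sumIns y (sumIns x f) w
sumIns-comm x y f [] = begin
  f (y ∷ x ∷ []) + f (x ∷ y ∷ [])  ≡⟨ +-comm (f (y ∷ x ∷ [])) _ ⟩
  f (x ∷ y ∷ []) + f (y ∷ x ∷ [])  ∎
  where open ≡.≡-Reasoning
sumIns-comm x y f (z ∷ zs) = begin
  (yxz + (xyz + X)) + sumIns x (λ u → f (y ∷ z ∷ u) + sumIns y (f ∘ (z ∷_)) u) zs
    ≡⟨ cong (yxz + (xyz + X) +_) (sumIns-+ x _ _ zs) ⟩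
  (yxz + (xyz + X)) + (Y + sumIns x (sumIns y (f ∘ (z ∷_))) zs)
    ≡⟨ cong (λ t → (yxz + (xyz + X)) + (Y + t)) (sumIns-comm x y _ zs) ⟩
  (yxz + (xyz + X)) + (Y + sumIns y (sumIns x (f ∘ (z ∷_))) zs)
    ≡⟨ regroup yxz xyz X Y _ ⟩
  (xyz + (yxz + Y)) + (X + sumIns y (sumIns x (f ∘ (z ∷_))) zs)
    ≡⟨ cong (xyz + (yxz + Y) +_) (sumIns-+ y _ _ zs) ⟨
  (xyz + (yxz + Y)) + sumIns y (λ u → f (x ∷ z ∷ u) + sumIns x (f ∘ (z ∷_)) u) zs  ∎
  where
  open ≡.≡-Reasoning
  xyz = f (x ∷ y ∷ z ∷ zs)
  yxz = f (y ∷ x ∷ z ∷ zs)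
  X = sumIns y (λ u → f (x ∷ z ∷ u)) zs
  Y = sumIns x (λ u → f (y ∷ z ∷ u)) zs
  regroup : ∀ a b c d e → (a + (b + c)) + (d + e) ≡ (b + (a + d)) + (c + e)
  regroup = solve-∀

sumPerms-mono : ∀ xs {f g} → (∀ w → w ↭ xs → f w ≤ g w) → sumPerms xs f ≤ sumPerms xs g
sumPerms-mono []       le = le [] ↭-refl
sumPerms-mono (x ∷ xs) le = sumPerms-mono xs λ w w↭ → sumIns-mono x w λ as bs eq →
  le (as ++ x ∷ bs) (↭-trans (shift x as bs) (prep x (subst (_↭ xs) (sym eq) w↭)))

sumPerms-cong : ∀ xs {f g} → (∀ w → w ↭ xs → f w ≡ g w) → sumPerms xs f ≡ sumPerms xs g
sumPerms-cong xs eq = ≤-antisym (sumPerms-mono xs λ w w↭ → ≤-reflexive (eq w w↭))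
                                (sumPerms-mono xs λ w w↭ → ≤-reflexive (sym (eq w w↭)))

sumPerms-+ : ∀ xs f g → sumPerms xs (λ w → f w + g w) ≡ sumPerms xs f + sumPerms xs g
sumPerms-+ []       f g = refl
sumPerms-+ (x ∷ xs) f g =
  ≡.trans (sumPerms-cong xs λ w _ → sumIns-+ x f g w) (sumPerms-+ xs (sumIns x f) (sumIns x g))

sumPerms-const : ∀ xs c → sumPerms xs (λ _ → c) ≡ length xs ! * c
sumPerms-const []       c = sym (+-identityʳ c)
sumPerms-const (x ∷ xs) c = begin
  sumPerms xs (sumIns x (λ _ → c))              ≡⟨ sumPerms-cong xs (λ w w↭ →
    ≡.trans (sumIns-const x c w) (cong (λ l → suc l * c) (↭-length w↭))) ⟩
  sumPerms xs (λ _ → suc (length xs) * c)       ≡⟨ sumPerms-const xs _ ⟩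
  length xs ! * (suc (length xs) * c)           ≡⟨ *-assoc (length xs !) _ c ⟨
  length xs ! * suc (length xs) * c             ≡⟨ cong (_* c) (*-comm (length xs !) _) ⟩
  suc (length xs) ! * c                         ∎
  where open ≡.≡-Reasoning

sumPerms-* : ∀ xs c f → sumPerms xs (λ w → c * f w) ≡ c * sumPerms xs f
sumPerms-* xs zero    f = ≡.trans (sumPerms-const xs 0) (*-zeroʳ (length xs !))
sumPerms-* xs (suc c) f = ≡.trans (sumPerms-+ xs f _) (cong (sumPerms xs f +_) (sumPerms-* xs c f))

sumPerms-↭ : ∀ {xs ys} f → xs ↭ ys → sumPerms xs f ≡ sumPerms ys f
sumPerms-↭ f refl             = refl
sumPerms-↭ f (prep x p)       = sumPerms-↭ (sumIns x f) p
sumPerms-↭ {_ ∷ _ ∷ xs} f (swap x y p) =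
  ≡.trans (sumPerms-cong xs λ w _ → sumIns-comm y x f w) (sumPerms-↭ _ p)
sumPerms-↭ f (Perm.trans p q) = ≡.trans (sumPerms-↭ f p) (sumPerms-↭ f q)

-- Cardinalities as sums over words

𝟙 : Bool → ℕ
𝟙 b = if b then 1 else 0

sum-perms : ∀ xs f → sum (map f (perms xs)) ≡ sumPerms xs f
sum-perms []       f = +-identityʳ (f [])
sum-perms (x ∷ xs) f = begin
  sum (map f (concatMap (insertions x) (perms xs)))  ≡⟨ sum-concatMap (perms xs) ⟩
  sum (map (sumIns x f) (perms xs))                  ≡⟨ sum-perms xs (sumIns x f) ⟩
  sumPerms xs (sumIns x f)                           ∎
  where
  open ≡.≡-Reasoning
  sum-insertions : ∀ f w → sum (map f (insertions x w)) ≡ sumIns x f w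
  sum-insertions f []       = +-identityʳ (f [ x ])
  sum-insertions f (y ∷ ys) = cong (f (x ∷ y ∷ ys) +_)
    (≡.trans (cong sum (sym (map-∘ (insertions x ys)))) (sum-insertions (f ∘ (y ∷_)) ys))
  sum-concatMap : ∀ ws → sum (map f (concatMap (insertions x) ws)) ≡ sum (map (sumIns x f) ws)
  sum-concatMap []       = refl
  sum-concatMap (w ∷ ws) = begin
    sum (map f (insertions x w ++ concatMap (insertions x) ws))
      ≡⟨ cong sum (map-++ f (insertions x w) _) ⟩
    sum (map f (insertions x w) ++ map f (concatMap (insertions x) ws))
      ≡⟨ sum-++ (map f (insertions x w)) _ ⟩
    sum (map f (insertions x w)) + sum (map f (concatMap (insertions x) ws))
      ≡⟨ cong₂ _+_ (sum-insertions f w) (sum-concatMap ws) ⟩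
    sumIns x f w + sum (map (sumIns x f) ws)  ∎

countB-perms : ∀ p xs → countB p (perms xs) ≡ sumPerms xs (𝟙 ∘ p)
countB-perms p xs = ≡.trans (countB-sum (perms xs)) (sum-perms xs (𝟙 ∘ p))
  where
  countB-sum : ∀ ws → countB p ws ≡ sum (map (𝟙 ∘ p) ws)
  countB-sum []       = refl
  countB-sum (w ∷ ws) = cong (𝟙 (p w) +_) (countB-sum ws)

countB-complement : ∀ p xs → countB p (perms xs) + sumPerms xs (𝟙 ∘ not ∘ p) ≡ length xs !
countB-complement p xs = begin
  countB p (perms xs) + sumPerms xs (𝟙 ∘ not ∘ p)       ≡⟨ cong (_+ sumPerms xs (𝟙 ∘ not ∘ p)) (countB-perms p xs) ⟩
  sumPerms xs (𝟙 ∘ p) + sumPerms xs (𝟙 ∘ not ∘ p)       ≡⟨ sumPerms-+ xs _ _ ⟨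
  sumPerms xs (λ w → 𝟙 (p w) + 𝟙 (not (p w)))           ≡⟨ sumPerms-cong xs (λ w _ → either (p w)) ⟩
  sumPerms xs (λ _ → 1)                                 ≡⟨ sumPerms-const xs 1 ⟩
  length xs ! * 1                                       ≡⟨ *-identityʳ _ ⟩
  length xs !                                           ∎
  where
  open ≡.≡-Reasoning
  either : ∀ b → 𝟙 b + 𝟙 (not b) ≡ 1
  either true  = refl
  either false = refl

-- Words containing a given subsequence

opaque
  contains : List ℕ → List ℕ → ℕ
  contains S w = 𝟙 (does (S ⊆? w))

  contains-mono : ∀ {S w S′ w′} → (S ⊆ w → S′ ⊆ w′) → contains S w ≤ contains S′ w′
  contains-mono {S} {w} {S′} {w′} f with S ⊆? w | S′ ⊆? w′
  ... | no _  | _     = z≤n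
  ... | yes _ | yes _ = ≤-refl
  ... | yes p | no ¬q = contradiction (f p) ¬q

  contains-⊈ : ∀ {S w} → ¬ S ⊆ w → contains S w ≡ 0
  contains-⊈ {S} {w} ¬p with S ⊆? w
  ... | no _  = refl
  ... | yes p = contradiction p ¬p

  contains-⊆ : ∀ {S w} → S ⊆ w → contains S w ≡ 1
  contains-⊆ {S} {w} p with S ⊆? w
  ... | no ¬p = contradiction p ¬p
  ... | yes _ = refl

⊆-uninsert : ∀ {S : List ℕ} {y} as {bs} → y ∉ S → S ⊆ as ++ y ∷ bs → S ⊆ as ++ bs
⊆-uninsert []       y∉S (_ ∷ʳ p)   = p
⊆-uninsert []       y∉S (refl ∷ p) = contradiction (here refl) y∉S
⊆-uninsert (a ∷ as) y∉S (.a ∷ʳ p)  = a ∷ʳ ⊆-uninsert as y∉S p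
⊆-uninsert (a ∷ as) y∉S (refl ∷ p) = refl ∷ ⊆-uninsert as (y∉S ∘ there) p

⊆-insertion : ∀ {x : ℕ} {S} as {bs} → x ∉ as → x ∷ S ⊆ as ++ x ∷ bs → S ⊆ bs
⊆-insertion []       x∉ (refl ∷ p)  = p
⊆-insertion []       x∉ (_ ∷ʳ p)    = ∷ˡ⁻ p
⊆-insertion (a ∷ as) x∉ (_ ∷ʳ p)    = ⊆-insertion as (x∉ ∘ there) p
⊆-insertion (a ∷ as) x∉ (refl ∷ p)  = contradiction (here refl) x∉

-- The letter x has to come first: behind any later position fewer letters remain than S needs. This
-- leaves a single position for each letter.
sumPerms-contains-self : ∀ S → Unique S → sumPerms S (contains S) ≤ 1
sumPerms-contains-self []      _           = ≤-reflexive (contains-⊆ [])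
sumPerms-contains-self (x ∷ S) (x≢ ∷ uniq) =
  ≤-trans (sumPerms-mono S only-first) (sumPerms-contains-self S uniq)
  where
  only-first : ∀ w → w ↭ S → sumIns x (contains (x ∷ S)) w ≤ contains S w
  only-first []      w↭ = contains-mono (⊆-insertion [] (λ ()))
  only-first (y ∷ w) w↭ = begin
    contains (x ∷ S) (x ∷ y ∷ w) + sumIns x (contains (x ∷ S) ∘ (y ∷_)) w
      ≤⟨ +-mono-≤ (contains-mono (⊆-insertion [] (λ ()))) (sumIns-bound x 0 w not-later) ⟩
    contains S (y ∷ w) + suc (length w) * 0
      ≡⟨ cong (contains S (y ∷ w) +_) (*-zeroʳ (suc (length w))) ⟩
    contains S (y ∷ w) + 0
      ≡⟨ +-identityʳ _ ⟩
    contains S (y ∷ w) ∎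
    where
    open ≤-Reasoning
    x∉ : x ∉ y ∷ w
    x∉ x∈ = All.lookup x≢ (∈-resp-↭ w↭ x∈) refl
    not-later : ∀ as bs → as ++ bs ≡ w → contains (x ∷ S) (y ∷ as ++ x ∷ bs) ≤ 0
    not-later as bs refl = ≤-reflexive (contains-⊈ λ p →
      <⇒≱ (s≤s (≤-trans (m≤n+m (length bs) (length as)) (≤-reflexive (sym (length-++ as)))))
          (≤-trans (≤-reflexive (↭-length w↭)) (length-mono-≤
            (⊆-insertion (y ∷ as) (λ x∈ → x∉ (∈-++⁺ˡ x∈)) p))))

complement : ∀ {S xs : List ℕ} → S ⊆ xs → Unique xs →
             ∃ λ ys → xs ↭ ys ++ S × All (_∉ S) ys
complement [] _ = [] , ↭-refl , []
complement (x ∷ʳ p) (x≢ ∷ uniq) with complement p uniq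
... | ys , xs↭ , ys∉ = x ∷ ys , prep x xs↭ , (λ x∈ → All.lookup x≢ (lookup p x∈) refl) ∷ ys∉
complement {x ∷ S} (refl ∷ p) (x≢ ∷ uniq) with complement p uniq
... | ys , xs↭ , ys∉ = ys , ↭-trans (prep x xs↭) (↭-sym (shift x ys S)) ,
  All.tabulate λ { y∈ (here refl) → All.lookup x≢ (∈-resp-↭ (↭-sym xs↭) (∈-++⁺ˡ y∈)) refl
                 ; y∈ (there y∈S) → All.lookup ys∉ y∈ y∈S }

Unique-⊆ : ∀ {S xs : List ℕ} → S ⊆ xs → Unique xs → Unique S
Unique-⊆ []         _             = []
Unique-⊆ (_ ∷ʳ p)   (_ ∷ uniq)    = Unique-⊆ p uniq
Unique-⊆ (refl ∷ p) (x≢ ∷ uniq)   = All-resp-⊆ p x≢ ∷ Unique-⊆ p uniq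

-- A random word contains S with probability at most 1/|S|!. The letters outside S are inserted
-- after those of S; removing such a letter preserves the containment, so inserting it multiplies
-- the sum at most by the number of positions.
sumPerms-contains : ∀ {S xs} → S ⊆ xs → Unique xs →
                    length S ! * sumPerms xs (contains S) ≤ length xs !
sumPerms-contains {S} {xs} p uniq with complement p uniq
... | ys , xs↭ , ys∉ = begin
  length S ! * sumPerms xs (contains S)         ≡⟨ cong (length S ! *_) (sumPerms-↭ (contains S) xs↭) ⟩
  length S ! * sumPerms (ys ++ S) (contains S)  ≤⟨ extend ys ys∉ ⟩
  length (ys ++ S) !                            ≡⟨ cong _! (↭-length xs↭) ⟨
  length xs !                                   ∎
  where
  open ≤-Reasoning
  extend : ∀ ys → All (_∉ S) ys → length S ! * sumPerms (ys ++ S) (contains S) ≤ length (ys ++ S) !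
  extend [] _ = ≤-trans (*-monoʳ-≤ (length S !) (sumPerms-contains-self S (Unique-⊆ p uniq)))
                        (≤-reflexive (*-identityʳ _))
  extend (y ∷ ys) (y∉ ∷ ys∉) = begin
    length S ! * sumPerms (ys ++ S) (sumIns y (contains S))
      ≤⟨ *-monoʳ-≤ (length S !) (sumPerms-mono (ys ++ S) λ w w↭ →
           ≤-trans (sumIns-bound y (contains S w) w
                      λ { as bs refl → contains-mono (⊆-uninsert as y∉) })
                   (≤-reflexive (cong (λ l → suc l * contains S w) (↭-length w↭)))) ⟩
    length S ! * sumPerms (ys ++ S) (λ w → suc l * contains S w)
      ≡⟨ cong (length S ! *_) (sumPerms-* (ys ++ S) (suc l) (contains S)) ⟩
    length S ! * (suc l * sumPerms (ys ++ S) (contains S))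
      ≡⟨ x*[y*z] (length S !) (suc l) _ ⟩
    suc l * (length S ! * sumPerms (ys ++ S) (contains S))
      ≤⟨ *-monoʳ-≤ (suc l) (extend ys ys∉) ⟩
    suc l ! ∎
    where
    l = length (ys ++ S)
    x*[y*z] : ∀ a b c → a * (b * c) ≡ b * (a * c)
    x*[y*z] = solve-∀

-- The expected number of increasing subsequences of length k

sumSub : ℕ → List ℕ → (List ℕ → ℕ) → ℕ
sumSub zero    xs       f = f []
sumSub (suc k) []       f = 0
sumSub (suc k) (x ∷ xs) f = sumSub k xs (f ∘ (x ∷_)) + sumSub (suc k) xs f

sumSub-≥ : ∀ {S xs} f → S ⊆ xs → f S ≤ sumSub (length S) xs f
sumSub-≥ {[]}    f p          = ≤-refl
sumSub-≥ {_ ∷ _} f (x ∷ʳ p)   = ≤-trans (sumSub-≥ f p) (m≤n+m _ _)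
sumSub-≥ {x ∷ _} f (refl ∷ p) = ≤-trans (sumSub-≥ (f ∘ (x ∷_)) p) (m≤m+n _ _)

sumPerms-sumSub : ∀ k xs ys (f : List ℕ → List ℕ → ℕ) →
  sumPerms ys (λ w → sumSub k xs (λ S → f S w)) ≡ sumSub k xs (λ S → sumPerms ys (f S))
sumPerms-sumSub zero    xs       ys f = refl
sumPerms-sumSub (suc k) []       ys f = ≡.trans (sumPerms-const ys 0) (*-zeroʳ (length ys !))
sumPerms-sumSub (suc k) (x ∷ xs) ys f =
  ≡.trans (sumPerms-+ ys _ _)
          (cong₂ _+_ (sumPerms-sumSub k xs ys (f ∘ (x ∷_))) (sumPerms-sumSub (suc k) xs ys f))

-- Two terms of the binomial expansion of (n + 1)^(k + 1). They match Pascal's recursion in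
-- `sumSub-bound`, which amounts to C(n,k) ≤ n^k/k!.
pow-suc-≥ : ∀ n k → suc k * n ^ k + n ^ suc k ≤ suc n ^ suc k
pow-suc-≥ n zero    = ≤-refl
pow-suc-≥ n (suc k) = begin
  suc (suc k) * n ^ suc k + n ^ suc (suc k)
    ≤⟨ m≤n+m _ (suc k * n ^ k) ⟩
  suc k * n ^ k + (suc (suc k) * n ^ suc k + n ^ suc (suc k))
    ≡⟨ expand n (suc k) (n ^ k) ⟩
  suc n * (suc k * n ^ k + n ^ suc k)
    ≤⟨ *-monoʳ-≤ (suc n) (pow-suc-≥ n k) ⟩
  suc n ^ suc (suc k) ∎
  where
  open ≤-Reasoning
  expand : ∀ n k p → k * p + (suc k * (n * p) + n * (n * p)) ≡ suc n * (k * p + n * p)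
  expand = solve-∀

sumSub-bound : ∀ k xs {f} c → (∀ S → S ⊆ xs → length S ≡ k → f S ≤ c) →
               k ! * sumSub k xs f ≤ length xs ^ k * c
sumSub-bound zero    xs       c le = *-monoʳ-≤ 1 (le [] (minimum xs) refl)
sumSub-bound (suc k) []       c le = ≤-trans (≤-reflexive (*-zeroʳ (suc k !))) z≤n
sumSub-bound (suc k) (x ∷ xs) {f} c le = begin
  suc k ! * (A + B)                             ≡⟨ expand (suc k) (k !) A B ⟩
  suc k * (k ! * A) + suc k ! * B               ≤⟨ +-mono-≤
    (*-monoʳ-≤ (suc k) (sumSub-bound k xs c λ S p eq → le (x ∷ S) (refl ∷ p) (cong suc eq)))
    (sumSub-bound (suc k) xs c λ S p → le S (x ∷ʳ p)) ⟩
  suc k * (n ^ k * c) + n ^ suc k * c           ≡⟨ collect (suc k) (n ^ k) (n ^ suc k) c ⟩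
  (suc k * n ^ k + n ^ suc k) * c               ≤⟨ *-monoˡ-≤ c (pow-suc-≥ n k) ⟩
  suc n ^ suc k * c                             ∎
  where
  open ≤-Reasoning
  n = length xs
  A = sumSub k xs (f ∘ (x ∷_))
  B = sumSub (suc k) xs f
  expand : ∀ k p a b → k * p * (a + b) ≡ k * (p * a) + k * p * b
  expand = solve-∀
  collect : ∀ k p q c → k * (p * c) + q * c ≡ (k * p + q) * c
  collect = solve-∀

sumPerms-subsequences : ∀ k xs → Unique xs →
  k ! * (k ! * sumPerms xs (λ w → sumSub k xs (λ S → contains S w))) ≤ length xs ^ k * length xs !
sumPerms-subsequences k xs uniq = begin
  k ! * (k ! * sumPerms xs (λ w → sumSub k xs (λ S → contains S w)))
    ≡⟨ cong (λ t → k ! * (k ! * t)) (sumPerms-sumSub k xs xs contains) ⟩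
  k ! * (k ! * sumSub k xs (λ S → sumPerms xs (contains S)))
    ≡⟨ cong (k ! *_) (sumSub-* k xs (k !)) ⟩
  k ! * sumSub k xs (λ S → k ! * sumPerms xs (contains S))
    ≤⟨ sumSub-bound k xs (length xs !) (λ { S p refl → sumPerms-contains p uniq }) ⟩
  length xs ^ k * length xs ! ∎
  where
  open ≤-Reasoning
  sumSub-* : ∀ k xs c {f} → c * sumSub k xs f ≡ sumSub k xs (λ S → c * f S)
  sumSub-* zero    xs       c = refl
  sumSub-* (suc k) []       c = *-zeroʳ c
  sumSub-* (suc k) (x ∷ xs) c =
    ≡.trans (*-distribˡ-+ c (sumSub k xs _) _) (cong₂ _+_ (sumSub-* k xs c) (sumSub-* (suc k) xs c))

-- The mean of 2^minima

minima-cong : ∀ {b c} w → All (_< b) w → All (_< c) w → minima b w ≡ minima c w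
minima-cong []      _         _         = refl
minima-cong (x ∷ w) (x<b ∷ _) (x<c ∷ _) = ≡.trans (minima-< w x<b) (sym (minima-< w x<c))

minima-insert : ∀ {b m} a as bs → a < m → m < b → minima b (a ∷ as ++ m ∷ bs) ≡ minima b (a ∷ as ++ bs)
minima-insert {b} {m} a as bs a<m m<b =
  ≡.trans (minima-< (as ++ m ∷ bs) a<b) (≡.trans (cong suc (skip-m a as a<m)) (sym (minima-< (as ++ bs) a<b)))
  where
  a<b = <-trans a<m m<b
  skip-m : ∀ c as → c < m → minima c (as ++ m ∷ bs) ≡ minima c (as ++ bs)
  skip-m c []       c<m = minima-≥ bs (<⇒≤ c<m)
  skip-m c (a ∷ as) c<m with a <? c
  ... | yes a<c = ≡.trans (minima-< (as ++ m ∷ bs) a<c)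
                    (≡.trans (cong suc (skip-m a as (<-trans a<c c<m))) (sym (minima-< (as ++ bs) a<c)))
  ... | no  a≮c = ≡.trans (minima-≥ (as ++ m ∷ bs) (≮⇒≥ a≮c))
                    (≡.trans (skip-m c as c<m) (sym (minima-≥ (as ++ bs) (≮⇒≥ a≮c))))

-- In front, the largest letter m is a new minimum and hides no other, so the weight doubles. At
-- every other position it stands behind a smaller letter and changes nothing.
sumIns-minima : ∀ {b m} w → All (_< m) w → m < b →
                sumIns m (λ u → 2 ^ minima b u) w ≡ suc (suc (length w)) * 2 ^ minima b w
sumIns-minima {b} {m} [] _ m<b = cong (2 ^_) (minima-< [] m<b)
sumIns-minima {b} {m} (a ∷ w) <m@(a<m ∷ _) m<b = begin
  2 ^ minima b (m ∷ a ∷ w) + sumIns m (λ u → 2 ^ minima b (a ∷ u)) w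
    ≡⟨ cong₂ _+_ (cong (2 ^_) front) (≤-antisym
         (sumIns-bound m c w λ { as bs refl → ≤-reflexive (later as bs) })
         (≤-trans (≤-reflexive (sym (sumIns-const m c w)))
                  (sumIns-mono m w λ { as bs refl → ≤-reflexive (sym (later as bs)) }))) ⟩
  2 * c + suc (length w) * c
    ≡⟨ *-distribʳ-+ c 2 (suc (length w)) ⟨
  suc (suc (suc (length w))) * c ∎
  where
  open ≡.≡-Reasoning
  c = 2 ^ minima b (a ∷ w)
  front : minima b (m ∷ a ∷ w) ≡ suc (minima b (a ∷ w))
  front = ≡.trans (minima-< (a ∷ w) m<b)
                  (cong suc (minima-cong (a ∷ w) <m (All.map (λ x<m → <-trans x<m m<b) <m)))
  later : ∀ as bs → 2 ^ minima b (a ∷ as ++ m ∷ bs) ≡ 2 ^ minima b (a ∷ as ++ bs)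
  later as bs = cong (2 ^_) (minima-insert a as bs a<m m<b)

-- `sumPerms` inserts the head of its list last, so the decreasing order of letters makes each
-- inserted letter the largest so far. The factors are 2, 3, ..., n + 1.
sumPerms-minima : ∀ b n → n < b →
                  sumPerms (applyDownFrom suc n) (λ w → 2 ^ minima b w) ≡ suc n !
sumPerms-minima b zero    _   = refl
sumPerms-minima b (suc n) n<b = begin
  sumPerms xs (sumIns (suc n) (λ u → 2 ^ minima b u))
    ≡⟨ sumPerms-cong xs (λ w w↭ → ≡.trans
         (sumIns-minima w (All.tabulate λ x∈ → All.lookup (all-below n) (∈-resp-↭ w↭ x∈)) n<b)
         (cong (λ l → suc (suc l) * 2 ^ minima b w) (≡.trans (↭-length w↭) (length-applyDownFrom suc n)))) ⟩
  sumPerms xs (λ w → suc (suc n) * 2 ^ minima b w)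
    ≡⟨ sumPerms-* xs (suc (suc n)) _ ⟩
  suc (suc n) * sumPerms xs (λ w → 2 ^ minima b w)
    ≡⟨ cong (suc (suc n) *_) (sumPerms-minima b n (<-trans (n<1+n n) n<b)) ⟩
  suc (suc n) ! ∎
  where
  open ≡.≡-Reasoning
  xs = applyDownFrom suc n
  all-below : ∀ n → All (_< suc n) (applyDownFrom suc n)
  all-below n = All.applyDownFrom⁺₁ suc n s<s

-- Numerical estimates

-- The top j factors of the factorial are all larger than m.
^≤! : ∀ m j → m ^ j ≤ (j + m) !
^≤! m zero    = 1≤n! m
^≤! m (suc j) = *-mono-≤ (≤-trans (m≤n+m m j) (n≤1+n _)) (^≤! m j)

^-distribʳ-* : ∀ m n o → (m * n) ^ o ≡ m ^ o * n ^ o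
^-distribʳ-* m n zero    = refl
^-distribʳ-* m n (suc o) = ≡.trans (cong (m * n *_) (^-distribʳ-* m n o)) (regroup m n (m ^ o) (n ^ o))
  where
  regroup : ∀ a b c d → a * b * (c * d) ≡ a * c * (b * d)
  regroup = solve-∀

n<2^n : ∀ n → n < 2 ^ n
n<2^n zero    = z<s
n<2^n (suc n) = begin-strict
  suc n            <⟨ +-mono-≤-< (m^n>0 2 n) (n<2^n n) ⟩
  2 ^ n + 2 ^ n    ≡⟨ cong (2 ^ n +_) (+-identityʳ _) ⟨
  2 ^ suc n        ∎
  where open ≤-Reasoning

-- Base 8 makes the cube root of n comparable to 2^b and n^(2/3) to 4^b, so all thresholds can be
-- powers of 2 up to constants and logarithms.
dyadic : ∀ n → 0 < n → ∃ λ b → 8 ^ b ≤ n × n < 8 ^ suc b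
dyadic (suc zero)    _ = 0 , s≤s z≤n , s≤s (s≤s z≤n)
dyadic (suc (suc n)) _ with dyadic (suc n) z<s
... | b , lo , hi with suc (suc n) <? 8 ^ suc b
...   | yes lt = b , ≤-trans lo (n≤1+n _) , lt
...   | no ¬lt = suc b , ≮⇒≥ ¬lt , (begin-strict
        suc (suc n)      ≤⟨ hi ⟩
        8 ^ suc b        <⟨ ^-monoʳ-< 8 (s≤s (s≤s z≤n)) (n<1+n (suc b)) ⟩
        8 ^ suc (suc b)  ∎)
  where open ≤-Reasoning

-- The left side is the value of 32 H in the extreme case d = b, as a function of b = 11 + j. The
-- exponent 11 is the least for which the inequality holds.
affine≤2^ : ∀ j → 128 * (11 + j) + 96 ≤ 2 ^ (11 + j)
affine≤2^ zero    = ≤ᵇ⇒≤ _ _ _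
affine≤2^ (suc j) = begin
  128 * (11 + suc j) + 96               ≡⟨ cong (λ t → 128 * t + 96) (+-suc 11 j) ⟩
  128 * suc (11 + j) + 96               ≡⟨ affine-suc (11 + j) ⟩
  128 + (128 * (11 + j) + 96)           ≤⟨ +-mono-≤ 128≤ (affine≤2^ j) ⟩
  2 ^ (11 + j) + 2 ^ (11 + j)           ≡⟨ cong (2 ^ (11 + j) +_) (+-identityʳ _) ⟨
  2 * 2 ^ (11 + j)                      ≡⟨ cong (2 ^_) (+-suc 11 j) ⟨
  2 ^ (11 + suc j)                      ∎
  where
  open ≤-Reasoning
  affine-suc : ∀ t → 128 * suc t + 96 ≡ 128 + (128 * t + 96)
  affine-suc = solve-∀
  128≤ : 128 ≤ 2 ^ (11 + j)
  128≤ = ^-monoʳ-≤ 2 {7} (m≤m+n 7 (4 + j))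

8^≡2^ : ∀ b → 8 ^ b ≡ 2 ^ (3 * b)
8^≡2^ b = ^-*-assoc 2 3 b

-- For 8^b ≤ n < 8^(b+1) the thresholds are H of order log n for the minima and k of order n^(2/3)
-- for the increasing subsequences, so that H k ≤ n while n^k is negligible against (k!)².
module Parameters (d b n : ℕ) (d≤b : d ≤ b) (11≤b : 11 ≤ b) (lo : 8 ^ b ≤ n) (hi : n < 8 ^ suc b) where
  open ≤-Reasoning
  L H m k : ℕ
  L = 3 * suc b
  -- Since 2^L ≥ n + 1, Markov's inequality for 2^minima leaves at most n!/2^d words with H or more
  -- minima.
  H = d + L
  -- From n < 8^(b+1) one gets n^(2/3) < 4^(b+1), so m = 8 · 4^b exceeds 2 n^(2/3) and m^6 > 64 n^4.
  m = 2 ^ (2 * b + 3)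
  k = m * 4

  1+n≤2^L : suc n ≤ 2 ^ L
  1+n≤2^L = ≤-trans hi (≤-reflexive (8^≡2^ (suc b)))

  H*k≤n : H * k ≤ n
  H*k≤n = begin
    H * (m * 4)                          ≡⟨ cong (λ t → H * (t * 4)) (^-distribˡ-+-* 2 (2 * b) 3) ⟩
    H * (2 ^ (2 * b) * 8 * 4)            ≡⟨ regroup H (2 ^ (2 * b)) ⟩
    2 ^ (2 * b) * (32 * H)               ≤⟨ *-monoʳ-≤ (2 ^ (2 * b)) 32H≤2^b ⟩
    2 ^ (2 * b) * 2 ^ b                  ≡⟨ ^-distribˡ-+-* 2 (2 * b) b ⟨
    2 ^ (2 * b + b)                      ≡⟨ cong (2 ^_) (+-comm (2 * b) b) ⟩
    2 ^ (3 * b)                          ≡⟨ 8^≡2^ b ⟨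
    8 ^ b                                ≤⟨ lo ⟩
    n                                    ∎
    where
    regroup : ∀ h p → h * (p * 8 * 4) ≡ p * (32 * h)
    regroup = solve-∀
    affine : ∀ b → 32 * (b + 3 * suc b) ≡ 128 * b + 96
    affine = solve-∀
    32H≤2^b : 32 * H ≤ 2 ^ b
    32H≤2^b = begin
      32 * (d + L)       ≤⟨ *-monoʳ-≤ 32 (+-monoˡ-≤ L d≤b) ⟩
      32 * (b + L)       ≡⟨ affine b ⟩
      128 * b + 96       ≤⟨ subst (λ b → 128 * b + 96 ≤ 2 ^ b) (m+[n∸m]≡n 11≤b) (affine≤2^ (b ∸ 11)) ⟩
      2 ^ b              ∎

  d≤m : d ≤ m
  d≤m = begin
    d            ≤⟨ d≤b ⟩
    b            ≤⟨ m≤n*m b 2 ⟩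
    2 * b        ≤⟨ m≤m+n (2 * b) 3 ⟩
    2 * b + 3    ≤⟨ <⇒≤ (n<2^n _) ⟩
    m            ∎

  2*n^4≤m^6 : 2 * n ^ 4 ≤ m ^ 6
  2*n^4≤m^6 = begin
    2 * n ^ 4                    ≤⟨ *-monoʳ-≤ 2 (^-monoˡ-≤ 4 (<⇒≤ 1+n≤2^L)) ⟩
    2 * (2 ^ L) ^ 4              ≡⟨ cong (2 *_) (^-*-assoc 2 L 4) ⟩
    2 ^ suc (L * 4)              ≤⟨ ^-monoʳ-≤ 2 exponents ⟩
    2 ^ ((2 * b + 3) * 6)        ≡⟨ ^-*-assoc 2 (2 * b + 3) 6 ⟨
    m ^ 6                        ∎
    where
    split : ∀ b → (2 * b + 3) * 6 ≡ suc (3 * suc b * 4) + 5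
    split = solve-∀
    exponents : suc (L * 4) ≤ (2 * b + 3) * 6
    exponents = ≤-trans (m≤m+n _ 5) (≤-reflexive (sym (split b)))

  -- The spare factor 2 in 2 n^4 ≤ m^6, raised to the power m, pays for 2^d. The rest is k! ≥
  -- m^(3m), used twice.
  2^d*n^k≤k!*k! : 2 ^ d * n ^ k ≤ k ! * k !
  2^d*n^k≤k!*k! = begin
    2 ^ d * n ^ (m * 4)                 ≤⟨ *-monoˡ-≤ _ (^-monoʳ-≤ 2 d≤m) ⟩
    2 ^ m * n ^ (m * 4)                 ≡⟨ cong (λ e → 2 ^ m * n ^ e) (*-comm m 4) ⟩
    2 ^ m * n ^ (4 * m)                 ≡⟨ cong (2 ^ m *_) (^-*-assoc n 4 m) ⟨
    2 ^ m * (n ^ 4) ^ m                 ≡⟨ ^-distribʳ-* 2 (n ^ 4) m ⟨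
    (2 * n ^ 4) ^ m                     ≤⟨ ^-monoˡ-≤ m 2*n^4≤m^6 ⟩
    (m ^ 6) ^ m                         ≡⟨ ^-*-assoc m 6 m ⟩
    m ^ (6 * m)                         ≡⟨ cong (m ^_) (six m) ⟩
    m ^ (m * 3 + m * 3)                 ≡⟨ ^-distribˡ-+-* m (m * 3) (m * 3) ⟩
    m ^ (m * 3) * m ^ (m * 3)           ≤⟨ *-mono-≤ m^3m≤k! m^3m≤k! ⟩
    k ! * k !                           ∎
    where
    six : ∀ m → 6 * m ≡ m * 3 + m * 3
    six = solve-∀
    four : ∀ m → m * 3 + m ≡ m * 4
    four = solve-∀
    m^3m≤k! : m ^ (m * 3) ≤ k !
    m^3m≤k! = ≤-trans (^≤! m (m * 3)) (≤-reflexive (cong _! (four m)))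

-- Words with a nonzero coefficient

decreasing-⊆ : ∀ n s → AllPairs _>_ s → All (λ a → 0 < a × a ≤ n) s → s ⊆ applyDownFrom suc n
decreasing-⊆ n       []      _          _                       = minimum _
decreasing-⊆ zero    (a ∷ s) _          ((0<a , a≤0) ∷ _)       = contradiction a≤0 (<⇒≱ 0<a)
decreasing-⊆ (suc n) (a ∷ s) (a> ∷ dec) ((0<a , a≤1+n) ∷ range) with a ≟ suc n
... | yes refl = refl ∷ decreasing-⊆ n s dec
  (All.zipWith (λ { (s<a , 0<s , _) → 0<s , ≤-pred s<a }) (a> , range))
... | no a≢1+n = suc n ∷ʳ decreasing-⊆ n (a ∷ s) (a> ∷ dec)
  ((0<a , a≤n) ∷ All.zipWith (λ { (s<a , 0<s , _) → 0<s , ≤-trans (<⇒≤ s<a) a≤n }) (a> , range))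
  where a≤n = ≤-pred (≤∧≢⇒< a≤1+n a≢1+n)

module Word (n : ℕ) where
  xs : List ℕ
  xs = applyUpTo suc n

  xs-unique : Unique xs
  xs-unique = applyUpTo⁺₁ suc n (λ i<j _ eq → <⇒≢ i<j (suc-injective eq))

  module _ {w} (w↭xs : w ↭ xs) where
    w-unique : Unique w
    w-unique = Permutationₛ.Unique-resp-↭ (setoid ℕ) (↭⇒↭ₛ (↭-sym w↭xs)) xs-unique

    w-range : All (λ a → 0 < a × a ≤ n) w
    w-range = All-resp-↭ (↭-sym w↭xs) (All.applyUpTo⁺₁ suc n (λ i<n → z<s , i<n))

    w-length : length w ≡ n
    w-length = ≡.trans (↭-length w↭xs) (length-applyUpTo suc n)

    -- Markov's inequality and the union bound in pointwise form. A word with nonzero coefficient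
    -- either has at least H minima, and the first summand suffices, or its long increasing
    -- subsequence has at least n/H ≥ k letters, and the second one does.
    nonzero-bound : ∀ H k → H * k ≤ n →
      2 ^ H * 𝟙 (not (isZero (coeffAlpha w))) ≤
      2 ^ minima (suc n) w + 2 ^ H * sumSub k xs (λ S → contains S w)
    nonzero-bound H k Hk≤n with isZero (coeffAlpha w) in eq
    ... | true  = ≤-trans (≤-reflexive (*-zeroʳ (2 ^ H))) z≤n
    ... | false with coeffAlpha≢0⇒decreasing (suc n) w w-unique (All.map (s≤s ∘ proj₂) w-range)
                       (λ c≡0 → contradiction (≡.trans (sym eq) (cong isZero c≡0)) λ ())
    ...   | s , s⊆ , dec , n≤ with H ≤? minima (suc n) w
    ...     | yes H≤ = ≤-trans (≤-reflexive (*-identityʳ _))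
                        (≤-trans (^-monoʳ-≤ 2 H≤) (m≤m+n _ _))
    ...     | no H≰ = ≤-trans (*-monoʳ-≤ (2 ^ H) contained) (m≤n+m _ _)
      where
      k≤|s| : k ≤ length s
      k≤|s| = ≮⇒≥ λ |s|<k → <⇒≱
        (begin-strict
          length w                        ≤⟨ n≤ ⟩
          minima (suc n) w * length s     ≤⟨ *-monoˡ-≤ (length s) (<⇒≤ (≰⇒> H≰)) ⟩
          H * length s                    <⟨ *-monoʳ-< H {{>-nonZero (≤-<-trans z≤n (≰⇒> H≰))}} |s|<k ⟩
          H * k                           ≤⟨ Hk≤n ⟩
          n                               ≡⟨ w-length ⟨
          length w                        ∎) ≤-refl
        where open ≤-Reasoning
      S : List ℕ
      -- The list s may be longer than k, so it is cut to exactly k letters; reversing turns the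
      -- decreasing sublist of `reverse w` into an increasing subsequence of w.
      S = reverse (take k s)
      |S|≡k : length S ≡ k
      |S|≡k = ≡.trans (length-reverse (take k s)) (≡.trans (length-take k s) (m≤n⇒m⊓n≡m k≤|s|))
      S⊆w : S ⊆ w
      S⊆w = subst (S ⊆_) (reverse-involutive w) (reverse⁺ (take-Sublist k s⊆))
      s-range : All (λ a → 0 < a × a ≤ n) s
      s-range = All-resp-⊆ s⊆ (All-resp-↭ (↭-sym (↭-reverse w)) w-range)
      -- A decreasing list of letters from 1 to n is a sublist of n, ..., 1, so S is among the
      -- sublists over which `sumSub` runs.
      S⊆xs : S ⊆ xs
      S⊆xs = subst (S ⊆_) (≡.trans (cong reverse (sym (reverse-applyUpTo suc n))) (reverse-involutive xs))
                   (reverse⁺ (take-Sublist k (decreasing-⊆ n s dec s-range)))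
      contained : 1 ≤ sumSub k xs (λ S → contains S w)
      contained = subst (λ k → 1 ≤ sumSub k xs (λ S → contains S w)) |S|≡k
                    (≤-trans (≤-reflexive (sym (contains-⊆ S⊆w))) (sumSub-≥ (λ S → contains S w) S⊆xs))

  nonzeros : ℕ
  nonzeros = sumPerms xs (𝟙 ∘ not ∘ isZero ∘ coeffAlpha)

  cardC+nonzeros : cardC n + nonzeros ≡ n !
  cardC+nonzeros = ≡.trans (countB-complement (isZero ∘ coeffAlpha) xs) (cong _! (length-applyUpTo suc n))

  increasing : ℕ → ℕ
  increasing k = sumPerms xs (λ w → sumSub k xs (λ S → contains S w))

  nonzeros-bound : ∀ H k → H * k ≤ n → 2 ^ H * nonzeros ≤ suc n ! + 2 ^ H * increasing k
  nonzeros-bound H k Hk≤n = begin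
    2 ^ H * nonzeros
      ≡⟨ sumPerms-* xs (2 ^ H) _ ⟨
    sumPerms xs (λ w → 2 ^ H * 𝟙 (not (isZero (coeffAlpha w))))
      ≤⟨ sumPerms-mono xs (λ w w↭ → nonzero-bound w↭ H k Hk≤n) ⟩
    sumPerms xs (λ w → 2 ^ minima (suc n) w + 2 ^ H * sumSub k xs (λ S → contains S w))
      ≡⟨ sumPerms-+ xs _ _ ⟩
    sumPerms xs (λ w → 2 ^ minima (suc n) w) + sumPerms xs (λ w → 2 ^ H * sumSub k xs (λ S → contains S w))
      ≡⟨ cong₂ _+_ (≡.trans (sumPerms-↭ _ xs↭down) (sumPerms-minima (suc n) n ≤-refl))
                   (sumPerms-* xs (2 ^ H) _) ⟩
    suc n ! + 2 ^ H * increasing k ∎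
    where
    open ≤-Reasoning
    xs↭down : xs ↭ applyDownFrom suc n
    xs↭down = subst (xs ↭_) (reverse-applyUpTo suc n) (↭-sym (↭-reverse xs))

  increasing-bound : ∀ k → k ! * (k ! * increasing k) ≤ n ^ k * n !
  increasing-bound k = subst (λ l → k ! * (k ! * increasing k) ≤ l ^ k * l !) (length-applyUpTo suc n)
                             (sumPerms-subsequences k xs xs-unique)

  -- Each of the two events has probability at most 2^(-d): many minima because 2^d (n + 1) ≤ 2^H, a
  -- long increasing subsequence because 2^d n^k ≤ (k!)².
  nonzeros-small : ∀ d b → d ≤ b → 11 ≤ b → 8 ^ b ≤ n → n < 8 ^ suc b → 2 ^ d * nonzeros ≤ 2 * n !
  nonzeros-small d b d≤b 11≤b lo hi = *-cancelˡ-≤ (2 ^ H) {{m^n≢0 2 H}} (begin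
    2 ^ H * (2 ^ d * nonzeros)                              ≡⟨ swapˡ (2 ^ H) (2 ^ d) _ ⟩
    2 ^ d * (2 ^ H * nonzeros)                              ≤⟨ *-monoʳ-≤ (2 ^ d) (nonzeros-bound H k H*k≤n) ⟩
    2 ^ d * (suc n * n ! + 2 ^ H * increasing k)            ≡⟨ regroup (2 ^ d) (suc n) (n !) (2 ^ H) _ ⟩
    2 ^ d * suc n * n ! + 2 ^ H * (2 ^ d * increasing k)    ≤⟨ +-mono-≤
      (*-monoˡ-≤ (n !) (*-monoʳ-≤ (2 ^ d) 1+n≤2^L)) (*-monoʳ-≤ (2 ^ H) 2^d*increasing≤n!) ⟩
    2 ^ d * 2 ^ L * n ! + 2 ^ H * n !                       ≡⟨ cong (λ t → t * n ! + 2 ^ H * n !) (^-distribˡ-+-* 2 d L) ⟨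
    2 ^ H * n ! + 2 ^ H * n !                               ≡⟨ double (2 ^ H) (n !) ⟩
    2 ^ H * (2 * n !)                                       ∎)
    where
    open Parameters d b n d≤b 11≤b lo hi using (L; H; k; 1+n≤2^L; H*k≤n; 2^d*n^k≤k!*k!)
    open ≤-Reasoning
    swapˡ : ∀ a b c → a * (b * c) ≡ b * (a * c)
    swapˡ = solve-∀
    regroup : ∀ a b c d e → a * (b * c + d * e) ≡ a * b * c + d * (a * e)
    regroup = solve-∀
    double : ∀ a b → a * b + a * b ≡ a * (2 * b)
    double = solve-∀
    pull : ∀ a b c → b * (a * c) ≡ a * b * c
    pull = solve-∀
    n>0 : 0 < n
    n>0 = ≤-trans (m^n>0 8 b) lo
    2^d*increasing≤n! : 2 ^ d * increasing k ≤ n !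
    2^d*increasing≤n! = *-cancelˡ-≤ (n ^ k) {{m^n≢0 n k {{>-nonZero n>0}}}} (begin
      n ^ k * (2 ^ d * increasing k)    ≡⟨ pull (2 ^ d) (n ^ k) _ ⟩
      2 ^ d * n ^ k * increasing k      ≤⟨ *-monoˡ-≤ (increasing k) 2^d*n^k≤k!*k! ⟩
      k ! * k ! * increasing k          ≡⟨ *-assoc (k !) (k !) _ ⟩
      k ! * (k ! * increasing k)        ≤⟨ increasing-bound k ⟩
      n ^ k * n !                       ∎)

-- From the count of nonzero coefficients to the limit

open Word using (nonzeros; cardC+nonzeros; nonzeros-small)

-- Taken with d = q + 1: one factor 2 absorbs the 2 of 2 · n!, and the remaining 2^q exceeds q. The
-- threshold on n forces b ≥ d + 11, which covers both d ≤ b and 11 ≤ b.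
nonzeros-negligible : ∀ q n → 8 ^ (suc q + 11) ≤ n → nonzeros n * q < n !
nonzeros-negligible q n N≤n with dyadic n (≤-trans (m^n>0 8 (suc q + 11)) N≤n)
... | b , lo , hi = scale (nonzeros n) (1≤n! n)
  (nonzeros-small n (suc q) b (≤-trans (m≤m+n (suc q) 11) d+11≤b) (≤-trans (m≤n+m 11 (suc q)) d+11≤b) lo hi)
  where
  d+11≤b : suc q + 11 ≤ b
  d+11≤b = ≮⇒≥ λ b<d+11 → <⇒≱ hi (≤-trans (^-monoʳ-≤ 8 b<d+11) N≤n)
  scale : ∀ x {f} → 0 < f → 2 ^ suc q * x ≤ 2 * f → x * q < f
  scale zero    0<f _  = 0<f
  scale (suc x) {f} _ le = begin-strict
    suc x * q      <⟨ *-monoʳ-< (suc x) (n<2^n q) ⟩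
    suc x * 2 ^ q  ≡⟨ *-comm (suc x) (2 ^ q) ⟩
    2 ^ q * suc x  ≤⟨ *-cancelˡ-≤ 2 (≤-trans (≤-reflexive (sym (*-assoc 2 (2 ^ q) (suc x)))) le) ⟩
    f              ∎
    where open ≤-Reasoning

open import Data.Integer using (+_)

complement-ratio : ∀ c x f .{{_ : NonZero f}} → c + x ≡ f → ∣ + c ℚ./ f - 1ℚ ∣ ≡ + x ℚ./ f
complement-ratio c x f@(suc m) c+x≡f = begin
  ∣ r - 1ℚ ∣             ≡⟨ cong (λ t → ∣ r - t ∣) r+y≡1 ⟨
  ∣ r - (r ℚ.+ y) ∣      ≡⟨ cong (λ t → ∣ r ℚ.+ t ∣) (ℚ.neg-distrib-+ r y) ⟩
  ∣ r ℚ.+ (ℚ.- r ℚ.- y) ∣  ≡⟨ cong ∣_∣ (ℚ.+-assoc r (ℚ.- r) (ℚ.- y)) ⟨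
  ∣ r ℚ.- r ℚ.- y ∣        ≡⟨ cong (λ t → ∣ t ℚ.- y ∣) (ℚ.+-inverseʳ r) ⟩
  ∣ 0ℚ ℚ.- y ∣             ≡⟨ cong ∣_∣ (ℚ.+-identityˡ (ℚ.- y)) ⟩
  ∣ ℚ.- y ∣                ≡⟨ ℚ.∣-p∣≡∣p∣ y ⟩
  ∣ y ∣                    ≡⟨ ℚ.0≤p⇒∣p∣≡p (ℚ.nonNegative⁻¹ y {{ℚ.normalize-nonNeg x f}}) ⟩
  y                        ∎
  where
  open ≡.≡-Reasoning
  r y : ℚ
  r = + c ℚ./ f
  y = + x ℚ./ f
  r+y≡1 : r ℚ.+ y ≡ 1ℚ
  r+y≡1 = ℚ.toℚᵘ-injective
    (ℚᵘ.≃-trans (ℚ.toℚᵘ-homo-+ r y)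
    (ℚᵘ.≃-trans (ℚᵘ.+-cong (ℚ.toℚᵘ-fromℚᵘ (ℚᵘ.mkℚᵘ (+ c) m)) (ℚ.toℚᵘ-fromℚᵘ (ℚᵘ.mkℚᵘ (+ x) m)))
    (ℚᵘ.*≡* (begin
      (+ c ℤ.* + f ℤ.+ + x ℤ.* + f) ℤ.* + 1   ≡⟨ ℤ.*-identityʳ _ ⟩
      + c ℤ.* + f ℤ.+ + x ℤ.* + f             ≡⟨ ℤ.*-distribʳ-+ (+ f) (+ c) (+ x) ⟨
      + (c + x) ℤ.* + f                       ≡⟨ cong (λ t → + t ℤ.* + f) c+x≡f ⟩
      + f ℤ.* + f                             ≡⟨ ℤ.*-identityˡ _ ⟨
      + 1 ℤ.* (+ f ℤ.* + f)                   ∎))))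

ratio-< : ∀ x f p q .{{_ : NonZero f}} .(coprime : Coprime (suc p) (suc q)) → x * suc q < f →
          + x ℚ./ f ℚ.< mkℚ (+ suc p) q coprime
ratio-< x (suc m) p q _ lt = ℚ.toℚᵘ-cancel-<
  (ℚᵘ.<-respˡ-≃ (ℚᵘ.≃-sym (ℚ.toℚᵘ-fromℚᵘ (ℚᵘ.mkℚᵘ (+ x) m)))
    (ℚᵘ.*<* (subst (ℤ._< + suc p ℤ.* + suc m) (ℤ.pos-* x (suc q))
      (ℤ.+<+ (<-≤-trans lt (m≤n*m (suc m) (suc p)))))))

theorem1p3 : (ε : ℚ) → 0ℚ ℚ.< ε →
    ∃ λ (N : ℕ) → (n : ℕ) → N ≤ n → ∣ ratio n - 1ℚ ∣ ℚ.< ε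
theorem1p3 (mkℚ (+ zero) q _)    (ℚ.*<* (ℤ.+<+ ()))
theorem1p3 (mkℚ (ℤ.-[1+ _ ]) q _) (ℚ.*<* ())
-- Here ε = (p + 1)/(q + 1) ≥ 1/(q + 1), so it is enough that the nonzero coefficients make up a
-- fraction below 1/(q + 1).
theorem1p3 (mkℚ (+ suc p) q c)   _ = 8 ^ (suc (suc q) + 11) , λ n N≤n →
  subst (ℚ._< mkℚ (+ suc p) q c)
        (sym (complement-ratio (cardC n) (nonzeros n) (n !) {{n !≢0}} (cardC+nonzeros n)))
        (ratio-< (nonzeros n) (n !) p q {{n !≢0}} c (nonzeros-negligible (suc q) n N≤n))
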